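{- Let $\mathcal{R}$ be a finite valuation ring of order $q^r$, where $q$ is a power of an odd prime, and let $n>1$ be an integer. For every constant $c>0$ there is a constant $C>0$ depending only on $c$ and $n$ such that: for every $\mathcal{A}\subset\mathcal{R}$ with $|\mathcal{A}|\ge 2q^{r-1}$ and \[|\mathcal{A}+\mathcal{A}|^{n-1}|\mathcal{A}|^n\ \ge\ c\, q^{\,r+(n-1)(2r-1)},\] one has \[\max\{|\mathcal{A}+\mathcal{A}|,\ |n\mathcal{A}^2|\}\ \ge\ C\, q^{\frac{r}{2n-1}}|\mathcal{A}|^{\frac{2n-2}{2n-1}}.\]
   Context: A finite valuation ring is a finite, local, principal commutative ring with identity. Its unique maximal ideal is $(z)$ for a uniformizer $z$; the residue field $\mathcal{R}/(z)$ has $q$ elements; $r$ is the smallest positive integer with $z^r=0$; then $|\mathcal{R}|=q^r$ and $|(z)|=q^{r-1}$. For $\mathcal{A}\subset\mathcal{R}$: $\mathcal{A}+\mathcal{A}=\{a+b: a,b\in\mathcal{A}\}$, $\mathcal{A}^2=\{x^2: x\in\mathcal{A}\}$, and for a positive integer $n$, $n\mathcal{A}^2$ is the set of all sums $a_1+\cdots+a_n$ with $a_1,\dots,a_n\in\mathcal{A}^2$. -}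

module Defs where

open import Level using (Level; _⊔_) renaming (suc to lsuc)
open import Algebra.Bundles using (CommutativeRing)
import Algebra.Properties.Semiring.Exp as SemiringExp
import Algebra.Definitions.RawMagma as RawMagmaDefs
import Algebra.Definitions.RawSemiring as RawSemiringDefs
open import Data.Fin.Base using (Fin)
open import Data.Fin.Properties using (any?; _≟_)
open import Data.Fin.Subset as Sub using (Subset; ⊤; ⁅_⁆; _⊆_)
open import Data.Fin.Subset.Properties using (_∈?_)
open import Data.Integer.Base using (+_)
open import Data.Nat.Base as ℕ using (ℕ; zero; suc)
open import Data.Nat.Divisibility using () renaming (_∣_ to _∣ℕ_)
open import Data.Nat.Primality using (Prime)
open import Data.Product using (∃; ∃₂; ∃!; _×_)
open import Data.Rational.Base as ℚ using (ℚ)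
open import Data.Sum.Base using (_⊎_)
open import Data.Vec.Base using (tabulate)
open import Function.Bundles using (Inverse; _⇔_)
open import Function.Definitions using (Congruent; Bijective)
open import Relation.Binary.PropositionalEquality using (_≡_; _≢_; setoid)
open import Relation.Nullary using (¬_; does)
open import Relation.Nullary.Decidable using (_×-dec_)

record FiniteCommutativeRing (a ℓ : Level) : Set (lsuc (a ⊔ ℓ)) where
  field
    commutativeRing : CommutativeRing a ℓ
    order           : ℕ
    enumeration     : Inverse (CommutativeRing.setoid commutativeRing) (setoid (Fin order))

  open CommutativeRing commutativeRing public
  open SemiringExp semiring public using (_^_)
  open RawMagmaDefs *-rawMagma public using (_∣_)

  index : Carrier → Fin order
  index = Inverse.to enumeration

  element : Fin order → Carrier
  element = Inverse.from enumeration

  -- A subset of the ring is a library subset of the set of indices, so that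
  -- its cardinality is the library's ∣_∣ and equality of subsets is _≡_.
  SubsetR : Set
  SubsetR = Subset order

  infix 4 _∈_

  _∈_ : Carrier → SubsetR → Set
  x ∈ A = index x Sub.∈ A

  infixl 6 _⊕_

  _⊕_ : SubsetR → SubsetR → SubsetR
  A ⊕ B = tabulate λ k → does (any? λ i → any? λ j →
    (i ∈? A) ×-dec (j ∈? B) ×-dec (k ≟ index (element i + element j)))

  -- The set of squares of elements of A (not the product set A · A).
  squares : SubsetR → SubsetR
  squares A = tabulate λ k → does (any? λ i →
    (i ∈? A) ×-dec (k ≟ index (element i * element i)))

  -- All sums a₁ + ⋯ + aₙ with every aᵢ in A (not the dilate of A by n).
  _-foldSum_ : ℕ → SubsetR → SubsetR
  zero  -foldSum A = ⁅ index 0# ⁆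
  suc n -foldSum A = A ⊕ (n -foldSum A)

  record IsIdeal (I : SubsetR) : Set (a ⊔ ℓ) where
    field
      0∈       : 0# ∈ I
      +-closed : ∀ {x y} → x ∈ I → y ∈ I → x + y ∈ I
      *-absorb : ∀ r {x} → x ∈ I → r * x ∈ I

  record IsMaximalIdeal (I : SubsetR) : Set (a ⊔ ℓ) where
    field
      isIdeal : IsIdeal I
      proper  : I ≢ ⊤
      maximal : ∀ J → IsIdeal J → I ⊆ J → J ≡ I ⊎ J ≡ ⊤

  _Generates_ : Carrier → SubsetR → Set (a ⊔ ℓ)
  g Generates I = ∀ x → x ∈ I ⇔ g ∣ x

  IsLocal : Set (a ⊔ ℓ)
  IsLocal = ∃! _≡_ IsMaximalIdeal

  IsPrincipal : Set (a ⊔ ℓ)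
  IsPrincipal = ∀ I → IsIdeal I → ∃ λ g → g Generates I

  IsUniformizer : Carrier → Set (a ⊔ ℓ)
  IsUniformizer z = ∃ λ m → IsMaximalIdeal m × z Generates m

  _≡_mod⟨_⟩ : Carrier → Carrier → Carrier → Set (a ⊔ ℓ)
  x ≡ y mod⟨ z ⟩ = z ∣ (x - y)

  -- R/(z) is the carrier with congruence modulo z as its equality.
  QuotientHasOrder : Carrier → ℕ → Set (a ⊔ ℓ)
  QuotientHasOrder z q = ∃ λ (f : Carrier → Fin q) →
    Congruent (λ x y → x ≡ y mod⟨ z ⟩) _≡_ f × Bijective (λ x y → x ≡ y mod⟨ z ⟩) _≡_ f

  record IsNilpotencyIndex (z : Carrier) (r : ℕ) : Set ℓ where
    field
      positive : 0 ℕ.< r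
      vanishes : z ^ r ≈ 0#
      least    : ∀ k → 0 ℕ.< k → z ^ k ≈ 0# → r ℕ.≤ k

-- The identities ∣R∣ = q ^ r and ∣(z)∣ = q ^ (r ∸ 1), where q = ∣R/(z)∣ and
-- r is the nilpotency index of a uniformizer z, are consequences of these
-- axioms and are not assumed.
record FiniteValuationRing (a ℓ : Level) : Set (lsuc (a ⊔ ℓ)) where
  field
    finiteCommutativeRing : FiniteCommutativeRing a ℓ

  open FiniteCommutativeRing finiteCommutativeRing public

  field
    isLocal     : IsLocal
    isPrincipal : IsPrincipal

IsOddPrimePower : ℕ → Set
IsOddPrimePower q = ∃₂ λ p k → Prime p × ¬ (2 ∣ℕ p) × 0 ℕ.< k × q ≡ p ℕ.^ k

fromℕ : ℕ → ℚ
fromℕ m = + m ℚ./ 1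

infixr 8 _^ℚ_

_^ℚ_ : ℚ → ℕ → ℚ
_^ℚ_ = RawSemiringDefs._^_ ℚ.+-*-rawSemiring

-- The inequality C · x^(1/d) ≤ y for C > 0 and d ≥ 1, with both sides raised
-- to the d-th power since the root need not be rational.
_·_^1/_≤_ : ℚ → ℕ → ℕ → ℕ → Set
C · x ^1/ d ≤ y = (C ^ℚ d) ℚ.* fromℕ x ℚ.≤ fromℕ y ^ℚ d

{-# OPTIONS --safe #-}

-- Put B = A + A, T = n A², m = n − 1 and let U be the set of units in A; as the
-- nonunits form the ideal (z) of size w = q^(r−1) ≤ |A| / 2, |U| ≥ |A| / 2.
-- For a ∈ Aᵐ and x ∈ U consider the sphere of all (b , t) with
-- x² + Σ (bᵢ − aᵢ)² = t.  It contains all points (a + a′ , x² + Σ a′ᵢ²) with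
-- a′ ∈ Aᵐ, which lie in Bᵐ × T, so there are at least |U| |A|^(2m) incidences
-- between the |A|ᵐ |U| spheres and the points of Bᵐ × T.
--
-- An upper bound comes from the variance, over all points of Rᵐ × R, of the
-- number of spheres through a point (N = |R| = q^r).  Two spheres meet in at
-- most N^(m−1) points if some aᵢ − a′ᵢ is a unit, since subtracting their
-- equations leaves a linear one (2 is a unit because q is odd).  Otherwise
-- a ≡ a′ modulo (z), which leaves wᵐ choices for a′; given a point, x′² is then
-- determined, so there are at most two choices for the unit x′.  By
-- Cauchy–Schwarz, either N |A|ᵐ ≤ 2 |B|ᵐ |T|, or
-- |A|^(3m+1) ≤ 16 |B|ᵐ |T| (w N)ᵐ, where w N = q^(2r−1); in the second case the
-- hypothesis on |A + A|^(n−1) |A|ⁿ replaces (w N)ᵐ.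

module Submission where

open import Defs
open import Level using (Level; 0ℓ)
open import Algebra.Bundles using (CommutativeRing; RawRing)
open import Algebra.Core using (Op₁; Op₂)
open import Algebra.Definitions.RawMagma using (module _∣ʳ_; _,_)
open import Algebra.Morphism.Structures using (module RingMorphisms)
import Algebra.Morphism.RingMonomorphism as RingMonomorphism
open import Algebra.Structures using (IsCommutativeRing)
open import Data.Bool.Base using (Bool; true; false; _∧_; not)
import Data.Bool.Properties as Bool
open import Data.Fin.Base using (Fin; zero; suc; combine; remQuot)
open import Data.Fin.Permutation using (Permutation; permutation)
open import Data.Fin.Properties using (_≟_; any?; remQuot-combine; combine-remQuot; injective⇒≤)
open import Data.Fin.Subset as Sub using (Subset; ∣_∣)
open import Data.Fin.Subset.Properties using (_∈?_; ∈⊤; ⊆-antisym; x∈⁅x⁆)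
import Data.Integer.Base as ℤ
import Data.Integer.Properties as ℤ
open import Data.List.Base using (List; []; _∷_; _++_; map; length; allFin; cartesianProductWith)
open import Data.List.Properties using (map-tabulate; length-tabulate)
open import Data.Maybe.Base using (Maybe; just; nothing)
open import Data.Nat.Base as ℕ using (ℕ; zero; suc; z≤n; s≤s; _≤_; NonZero)
open import Data.Nat.Divisibility using (divides; ∣1⇒≡1) renaming (_∣_ to _∣ℕ_)
open import Data.Nat.Primality using (prime[2]; prime⇒nonZero; euclidsLemma)
import Data.Nat.Properties as ℕ
open import Data.Nat.Solver using (module +-*-Solver)
open import Data.Product using (∃; _×_; _,_; proj₁; proj₂; uncurry)
open import Data.Rational using (ℚ; 0ℚ) renaming (_*_ to _*ℚ_; _<_ to _<ℚ_; _≤_ to _≤ℚ_)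
open import Data.Rational.Base as ℚ using (1ℚ; mkℚ; toℚᵘ)
import Data.Rational.Properties as ℚ
open import Data.Rational.Unnormalised.Base as ℚᵘ using (mkℚᵘ; *≤*)
import Data.Rational.Unnormalised.Properties as ℚᵘ
open import Data.Sum.Base as Sum using (_⊎_; inj₁; inj₂)
open import Data.Vec.Base using (Vec; []; _∷_; lookup; tabulate; zipWith)
open import Data.Vec.Properties using (lookup∘tabulate; []=⇒lookup; lookup⇒[]=)
open import Function.Base using (_∘_; id)
open import Function.Bundles using (Inverse; Equivalence)
open import Function.Definitions using (Injective)
open import Relation.Binary.PropositionalEquality hiding (J; setoid)
open import Relation.Nullary using (¬_; Dec; does; yes; no; contradiction)
open import Relation.Nullary.Decidable using (dec-true; _×-dec_)

-- Taking only units x is what makes congruent centres harmless. A square can have many nonunit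
-- roots (every multiple of a high enough power of z squares to 0), and then x′² would not limit x′;
-- for a unit x the equation x² = x′² factors with one factor a unit. The intersection bound N^(m-1)
-- equals the average number of common points of two spheres in Rᵐ × R. Pairs whose centres differ
-- by a unit somewhere are therefore absorbed by the square of the mean in the variance, and the
-- congruent pairs alone make up the error. Both alternatives lead to N |A|^(2m) ≤ const · |B|^(2m)
-- |T|. The first is multiplied by |A|ᵐ ≤ |B|ᵐ. The second is multiplied by the hypothesis, after
-- which (w N)ᵐ and |A|^(m+1) cancel. With M the larger of |B| and |T| the right side is at most
-- const · M^(2m+1), and 2m + 1 = 2n - 1 is the root in the conclusion.

does-true : ∀ {a} {A : Set a} (d : Dec A) → does d ≡ true → A
does-true (yes x) _ = x

-- Finite sums of natural numbers, Cauchy-Schwarz and a weighted incidence bound.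

module FiniteSums where
  open import Data.Nat hiding (_≟_)
  open import Data.Nat.Properties hiding (_≟_)

  ⟦_⟧ : Bool → ℕ
  ⟦ true ⟧  = 1
  ⟦ false ⟧ = 0

  ⟦∧⟧ : ∀ p q → ⟦ p ∧ q ⟧ ≡ ⟦ p ⟧ * ⟦ q ⟧
  ⟦∧⟧ true  q = sym (+-identityʳ _)
  ⟦∧⟧ false q = refl

  module _ {x} {X : Set x} where

    ∑ : List X → (X → ℕ) → ℕ
    ∑ []       f = 0
    ∑ (x ∷ xs) f = f x + ∑ xs f

    infixr 9 ∑
    syntax ∑ xs (λ x → e) = ∑[ x ∈ xs ] e

    ∑-mono : ∀ xs {f g : X → ℕ} → (∀ x → f x ≤ g x) → ∑ xs f ≤ ∑ xs g
    ∑-mono []       f≤g = z≤n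
    ∑-mono (x ∷ xs) f≤g = +-mono-≤ (f≤g x) (∑-mono xs f≤g)

    ∑-cong : ∀ xs {f g : X → ℕ} → (∀ x → f x ≡ g x) → ∑ xs f ≡ ∑ xs g
    ∑-cong []       f≡g = refl
    ∑-cong (x ∷ xs) f≡g = cong₂ _+_ (f≡g x) (∑-cong xs f≡g)

    ∑-+ : ∀ xs (f g : X → ℕ) → ∑[ x ∈ xs ] (f x + g x) ≡ ∑ xs f + ∑ xs g
    ∑-+ []       f g = refl
    ∑-+ (x ∷ xs) f g = trans (cong (f x + g x +_) (∑-+ xs f g))
      (solve 4 (λ a b c d → a :+ b :+ (c :+ d) := a :+ c :+ (b :+ d)) refl (f x) (g x) (∑ xs f) (∑ xs g))
      where open +-*-Solver

    ∑-*ˡ : ∀ xs c (f : X → ℕ) → ∑[ x ∈ xs ] (c * f x) ≡ c * ∑ xs f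
    ∑-*ˡ []       c f = sym (*-zeroʳ c)
    ∑-*ˡ (x ∷ xs) c f = trans (cong (c * f x +_) (∑-*ˡ xs c f)) (sym (*-distribˡ-+ c _ _))

    ∑-*ʳ : ∀ xs c (f : X → ℕ) → ∑[ x ∈ xs ] (f x * c) ≡ ∑ xs f * c
    ∑-*ʳ xs c f = trans (∑-cong xs λ x → *-comm (f x) c) (trans (∑-*ˡ xs c f) (*-comm c _))

    ∑-const : ∀ xs c → ∑[ _ ∈ xs ] c ≡ length xs * c
    ∑-const []       c = refl
    ∑-const (x ∷ xs) c = cong (c +_) (∑-const xs c)

    ∑-++ : ∀ xs ys (f : X → ℕ) → ∑ (xs ++ ys) f ≡ ∑ xs f + ∑ ys f
    ∑-++ []       ys f = refl
    ∑-++ (x ∷ xs) ys f = trans (cong (f x +_) (∑-++ xs ys f)) (sym (+-assoc (f x) _ _))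

  ∑-map : ∀ {x y} {X : Set x} {Y : Set y} xs (g : X → Y) f → ∑ (map g xs) f ≡ ∑ xs (f ∘ g)
  ∑-map []       g f = refl
  ∑-map (x ∷ xs) g f = cong (f (g x) +_) (∑-map xs g f)

  module _ {x y} {X : Set x} {Y : Set y} where

    ∑-comm : ∀ xs ys (f : X → Y → ℕ) → ∑[ x ∈ xs ] ∑[ y ∈ ys ] f x y ≡ ∑[ y ∈ ys ] ∑[ x ∈ xs ] f x y
    ∑-comm []       ys f = sym (trans (∑-const ys 0) (*-zeroʳ (length ys)))
    ∑-comm (x ∷ xs) ys f = trans (cong (∑ ys (f x) +_) (∑-comm xs ys f)) (sym (∑-+ ys (f x) _))

    ∑-*-∑ : ∀ xs ys (f : X → ℕ) (g : Y → ℕ) →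
            ∑ xs f * ∑ ys g ≡ ∑[ x ∈ xs ] ∑[ y ∈ ys ] (f x * g y)
    ∑-*-∑ xs ys f g = trans (sym (∑-*ʳ xs (∑ ys g) f)) (∑-cong xs λ x → sym (∑-*ˡ ys (f x) g))

    ∑-cartesianProductWith : ∀ {z} {Z : Set z} (h : X → Y → Z) xs ys (f : Z → ℕ) →
      ∑ (cartesianProductWith h xs ys) f ≡ ∑[ x ∈ xs ] ∑[ y ∈ ys ] f (h x y)
    ∑-cartesianProductWith h []       ys f = refl
    ∑-cartesianProductWith h (x ∷ xs) ys f =
      trans (∑-++ (map (h x) ys) _ f) (cong₂ _+_ (∑-map ys (h x) f) (∑-cartesianProductWith h xs ys f))

  -- An identity when n ≤ m. When m ≤ n the truncated square is 0 and the term (n - m)² is dropped.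
  -- This direction is the one that bounds a sum of squared excesses from above.
  [m∸n]²+2mn≤m²+n² : ∀ m n → (m ∸ n) * (m ∸ n) + (m * n + m * n) ≤ m * m + n * n
  [m∸n]²+2mn≤m²+n² m n with ≤-total n m
  ... | inj₁ n≤m with d , refl ← m≤n⇒∃[o]m+o≡n n≤m rewrite m+n∸m≡n n d = ≤-reflexive
    (solve 2 (λ n d → d :* d :+ ((n :+ d) :* n :+ (n :+ d) :* n) := (n :+ d) :* (n :+ d) :+ n :* n) refl n d)
    where open +-*-Solver
  ... | inj₂ m≤n with d , refl ← m≤n⇒∃[o]m+o≡n m≤n rewrite m≤n⇒m∸n≡0 m≤n = ≤-trans (m≤m+n _ (d * d)) (≤-reflexive
    (solve 2 (λ m d → m :* (m :+ d) :+ m :* (m :+ d) :+ d :* d := m :* m :+ (m :+ d) :* (m :+ d)) refl m d))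
    where open +-*-Solver

  2mn≤m²+n² : ∀ m n → m * n + m * n ≤ m * m + n * n
  2mn≤m²+n² m n = m+n≤o⇒n≤o ((m ∸ n) * (m ∸ n)) ([m∸n]²+2mn≤m²+n² m n)

  2*-cancel-≤ : ∀ {m n} → m + m ≤ n + n → m ≤ n
  2*-cancel-≤ {m} {n} le = ≮⇒≥ λ n<m → <⇒≱ (+-mono-< n<m n<m) le

  -- Both sides become double sums over (i , j). Doubling makes the right side symmetric in i and j,
  -- so that 2mn ≤ m² + n² applies termwise with m = f i · g j and n = f j · g i.
  cauchySchwarz : ∀ {x} {X : Set x} xs (f g : X → ℕ) →
    ∑[ x ∈ xs ] (f x * g x) * ∑[ x ∈ xs ] (f x * g x) ≤ ∑[ x ∈ xs ] (f x * f x) * ∑[ x ∈ xs ] (g x * g x)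
  cauchySchwarz {X = X} xs f g = 2*-cancel-≤ (begin
    fg * fg + fg * fg                                      ≡⟨ cong (λ t → t + t) (∑-*-∑ xs xs _ _) ⟩
    ∑∑ (λ i j → f i * g i * (f j * g j)) + ∑∑ (λ i j → f i * g i * (f j * g j))
                                                           ≡⟨ ∑∑-+ _ _ ⟨
    ∑∑ (λ i j → f i * g i * (f j * g j) + f i * g i * (f j * g j))
                                                           ≤⟨ ∑-mono xs (λ i → ∑-mono xs (pointwise i)) ⟩
    ∑∑ (λ i j → f i * f i * (g j * g j) + f j * f j * (g i * g i))
                                                           ≡⟨ ∑∑-+ _ _ ⟩
    ∑∑ (λ i j → f i * f i * (g j * g j)) + ∑∑ (λ i j → f j * f j * (g i * g i))
                                                           ≡⟨ cong₂ _+_ (sym (∑-*-∑ xs xs _ _)) (trans (∑-comm xs xs _) (sym (∑-*-∑ xs xs _ _))) ⟩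
    ff * gg + ff * gg                                      ∎)
    where
    open ≤-Reasoning
    fg = ∑[ x ∈ xs ] (f x * g x)
    ff = ∑[ x ∈ xs ] (f x * f x)
    gg = ∑[ x ∈ xs ] (g x * g x)
    ∑∑ : (X → X → ℕ) → ℕ
    ∑∑ F = ∑[ i ∈ xs ] ∑[ j ∈ xs ] F i j
    ∑∑-+ : ∀ F G → ∑∑ (λ i j → F i j + G i j) ≡ ∑∑ F + ∑∑ G
    ∑∑-+ F G = trans (∑-cong xs λ i → ∑-+ xs (F i) (G i)) (∑-+ xs _ _)
    pointwise : ∀ i j → f i * g i * (f j * g j) + f i * g i * (f j * g j) ≤ f i * f i * (g j * g j) + f j * f j * (g i * g i)
    pointwise i j = subst₂ _≤_
      (cong (λ t → t + t) (solve 4 (λ a b c d → a :* d :* (c :* b) := a :* b :* (c :* d)) refl (f i) (g i) (f j) (g j)))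
      (solve 4 (λ a b c d → a :* d :* (a :* d) :+ c :* b :* (c :* b) := a :* a :* (d :* d) :+ c :* c :* (b :* b)) refl (f i) (g i) (f j) (g j))
      (2mn≤m²+n² (f i * g j) (f j * g i))
      where open +-*-Solver

  δ : ∀ {n} → Fin n → Fin n → ℕ
  δ x y = ⟦ does (x ≟ y) ⟧

  δ-sym : ∀ {n} (x y : Fin n) → δ x y ≡ δ y x
  δ-sym zero    zero    = refl
  δ-sym zero    (suc y) = refl
  δ-sym (suc x) zero    = refl
  δ-sym (suc x) (suc y) = δ-sym x y

  δ-refl : ∀ {n} (x : Fin n) → δ x x ≡ 1
  δ-refl zero    = refl
  δ-refl (suc x) = δ-refl x

  ∑-allFin-suc : ∀ {n} (f : Fin (suc n) → ℕ) → ∑ (allFin (suc n)) f ≡ f zero + ∑ (allFin n) (f ∘ suc)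
  ∑-allFin-suc {n} f = cong (f zero +_)
    (trans (cong (λ xs → ∑ xs f) (sym (map-tabulate id suc))) (∑-map (allFin n) suc f))

  ∑-δ : ∀ {n} (f : Fin n → ℕ) c → ∑[ x ∈ allFin n ] (δ x c * f x) ≡ f c
  ∑-δ {suc n} f zero    = trans (∑-allFin-suc (λ x → δ x zero * f x))
    (trans (cong (1 * f zero +_) (trans (∑-const (allFin n) 0) (*-zeroʳ (length (allFin n)))))
           (trans (+-identityʳ _) (*-identityˡ _)))
  ∑-δ {suc n} f (suc c) = trans (∑-allFin-suc (λ x → δ x (suc c) * f x)) (∑-δ (f ∘ suc) c)

  ∑-δ₁ : ∀ {n} (c : Fin n) → ∑[ x ∈ allFin n ] δ x c ≡ 1
  ∑-δ₁ {n} c = trans (∑-cong (allFin n) λ x → sym (*-identityʳ (δ x c))) (∑-δ (λ _ → 1) c)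

  ∑-δ₁ʳ : ∀ {n} (c : Fin n) → ∑[ x ∈ allFin n ] δ c x ≡ 1
  ∑-δ₁ʳ {n} c = trans (∑-cong (allFin n) (δ-sym c)) (∑-δ₁ c)

  ∑-atMostOne : ∀ {n} (p : Fin n → Bool) → (∀ {x y} → p x ≡ true → p y ≡ true → x ≡ y) →
                ∑[ x ∈ allFin n ] ⟦ p x ⟧ ≤ 1
  ∑-atMostOne {n} p unique with any? (λ x → p x Bool.≟ true)
  ... | yes (x₀ , px₀) = ≤-trans (∑-mono (allFin n) bound) (≤-reflexive (∑-δ₁ x₀))
    where
    bound : ∀ x → ⟦ p x ⟧ ≤ δ x x₀
    bound x with p x in px
    ... | false = z≤n
    ... | true rewrite unique px px₀ = ≤-reflexive (sym (δ-refl x₀))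
  ... | no ∄x = ≤-trans (∑-mono (allFin n) {g = λ _ → 0} bound)
                  (≤-trans (≤-reflexive (trans (∑-const (allFin n) 0) (*-zeroʳ (length (allFin n))))) z≤n)
    where
    bound : ∀ x → ⟦ p x ⟧ ≤ 0
    bound x with p x in px
    ... | false = z≤n
    ... | true  = contradiction (x , px) ∄x

  -- Every y has at most one preimage, so f y is counted at most once on the left. Translations and
  -- reflections of the ring are later used as changes of variable through this inequality, on the
  -- strength of injectivity alone.
  ∑-injective : ∀ {m n} (π : Fin m → Fin n) → Injective _≡_ _≡_ π → ∀ f →
                ∑ (allFin m) (f ∘ π) ≤ ∑ (allFin n) f
  ∑-injective {m} {n} π inj f = begin
    ∑ (allFin m) (f ∘ π)                                       ≡⟨ ∑-cong (allFin m) (λ x → ∑-δ f (π x)) ⟨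
    ∑[ x ∈ allFin m ] ∑[ y ∈ allFin n ] (δ y (π x) * f y)      ≡⟨ ∑-comm (allFin m) (allFin n) _ ⟩
    ∑[ y ∈ allFin n ] ∑[ x ∈ allFin m ] (δ y (π x) * f y)      ≡⟨ ∑-cong (allFin n) (λ y → ∑-*ʳ (allFin m) (f y) _) ⟩
    ∑[ y ∈ allFin n ] (∑[ x ∈ allFin m ] δ y (π x) * f y)      ≤⟨ ∑-mono (allFin n) (λ y → *-monoˡ-≤ (f y) (fibre y)) ⟩
    ∑[ y ∈ allFin n ] (1 * f y)                                ≡⟨ ∑-cong (allFin n) (λ y → *-identityˡ (f y)) ⟩
    ∑ (allFin n) f                                             ∎
    where
    open ≤-Reasoning
    fibre : ∀ y → ∑[ x ∈ allFin m ] δ y (π x) ≤ 1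
    fibre y = ∑-atMostOne (λ x → does (y ≟ π x)) λ {x} {x′} e e′ →
      inj (trans (sym (does-true (y ≟ π x) e)) (does-true (y ≟ π x′) e′))

  -- The incidences of a weighted point set with a weighted family of curves are
  -- controlled by the variance of J, the number of curves through a point; only
  -- the excess of J over its mean h / N matters, so truncated subtraction is
  -- harmless.
  module _ {x y} {X : Set x} {Y : Set y} (curves : List X) (points : List Y)
           (c : X → ℕ) (w : Y → ℕ) (ι : X → Y → ℕ) (N D E : ℕ) where

    private
      h = ∑ curves c

      J : Y → ℕ
      J y = ∑[ x ∈ curves ] (c x * ι x y)

      excess : Y → ℕ
      excess y = N * J y ∸ h

    incidenceBound :
      (∀ x → ∑ points (ι x) ≡ D) →
      length points ≡ N * D →
      (∀ x → N * ∑[ x′ ∈ curves ] (c x′ * ∑[ y ∈ points ] (ι x y * ι x′ y)) ≤ h * D + E) →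
      (∀ y → w y * w y ≤ w y) →
      ∃ λ S → N * ∑[ y ∈ points ] (w y * J y) ≤ S + ∑ points w * h ×
              S * S ≤ ∑ points w * (N * (h * E))
    incidenceBound degree size correlation w²≤w = S , incidences , squared
      where
      open ≤-Reasoning
      open +-*-Solver

      S = ∑[ y ∈ points ] (w y * excess y)

      incidences : N * ∑[ y ∈ points ] (w y * J y) ≤ S + ∑ points w * h
      incidences = begin
        N * ∑[ y ∈ points ] (w y * J y)                        ≡⟨ ∑-*ˡ points N _ ⟨
        ∑[ y ∈ points ] (N * (w y * J y))                      ≤⟨ ∑-mono points (λ y → begin
          N * (w y * J y)                                        ≡⟨ solve 3 (λ n w j → n :* (w :* j) := w :* (n :* j)) refl N (w y) (J y) ⟩
          w y * (N * J y)                                        ≤⟨ *-monoʳ-≤ (w y) (m≤n+m∸n (N * J y) h) ⟩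
          w y * (h + excess y)                                   ≡⟨ solve 3 (λ w h e → w :* (h :+ e) := w :* e :+ w :* h) refl (w y) h (excess y) ⟩
          w y * excess y + w y * h                               ∎) ⟩
        ∑[ y ∈ points ] (w y * excess y + w y * h)             ≡⟨ ∑-+ points _ _ ⟩
        S + ∑[ y ∈ points ] (w y * h)                          ≡⟨ cong (S +_) (∑-*ʳ points h w) ⟩
        S + ∑ points w * h                                     ∎

      first : ∑ points J ≡ h * D
      first = begin-equality
        ∑ points J                                             ≡⟨ ∑-comm points curves _ ⟩
        ∑[ x ∈ curves ] ∑[ y ∈ points ] (c x * ι x y)          ≡⟨ ∑-cong curves (λ x → trans (∑-*ˡ points (c x) (ι x)) (cong (c x *_) (degree x))) ⟩
        ∑[ x ∈ curves ] (c x * D)                              ≡⟨ ∑-*ʳ curves D c ⟩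
        h * D                                                  ∎

      expand : ∑[ y ∈ points ] (J y * J y) ≡
               ∑[ x ∈ curves ] (c x * ∑[ x′ ∈ curves ] (c x′ * ∑[ y ∈ points ] (ι x y * ι x′ y)))
      expand = begin-equality
        ∑[ y ∈ points ] (J y * J y)
          ≡⟨ ∑-cong points (λ y → ∑-*ʳ curves (J y) _) ⟨
        ∑[ y ∈ points ] ∑[ x ∈ curves ] (c x * ι x y * J y)
          ≡⟨ ∑-comm points curves _ ⟩
        ∑[ x ∈ curves ] ∑[ y ∈ points ] (c x * ι x y * J y)
          ≡⟨ ∑-cong curves (λ x → begin-equality
            ∑[ y ∈ points ] (c x * ι x y * J y)
              ≡⟨ ∑-cong points (λ y → *-assoc (c x) (ι x y) (J y)) ⟩
            ∑[ y ∈ points ] (c x * (ι x y * J y))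
              ≡⟨ ∑-*ˡ points (c x) _ ⟩
            c x * ∑[ y ∈ points ] (ι x y * J y)
              ≡⟨ cong (c x *_) (∑-cong points λ y → sym (∑-*ˡ curves (ι x y) _)) ⟩
            c x * ∑[ y ∈ points ] ∑[ x′ ∈ curves ] (ι x y * (c x′ * ι x′ y))
              ≡⟨ cong (c x *_) (∑-comm points curves _) ⟩
            c x * ∑[ x′ ∈ curves ] ∑[ y ∈ points ] (ι x y * (c x′ * ι x′ y))
              ≡⟨ cong (c x *_) (∑-cong curves λ x′ → trans
                   (∑-cong points λ y → solve 3 (λ i c i′ → i :* (c :* i′) := c :* (i :* i′)) refl (ι x y) (c x′) (ι x′ y))
                   (∑-*ˡ points (c x′) _)) ⟩
            c x * ∑[ x′ ∈ curves ] (c x′ * ∑[ y ∈ points ] (ι x y * ι x′ y)) ∎) ⟩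
        ∑[ x ∈ curves ] (c x * ∑[ x′ ∈ curves ] (c x′ * ∑[ y ∈ points ] (ι x y * ι x′ y))) ∎

      second : N * ∑[ y ∈ points ] (J y * J y) ≤ h * (h * D + E)
      second = begin
        N * ∑[ y ∈ points ] (J y * J y)                        ≡⟨ cong (N *_) expand ⟩
        N * ∑[ x ∈ curves ] (c x * _)                          ≡⟨ ∑-*ˡ curves N _ ⟨
        ∑[ x ∈ curves ] (N * (c x * _))                        ≤⟨ ∑-mono curves (λ x → ≤-trans
          (≤-reflexive (solve 3 (λ n c k → n :* (c :* k) := c :* (n :* k)) refl N (c x) _))
          (*-monoʳ-≤ (c x) (correlation x))) ⟩
        ∑[ x ∈ curves ] (c x * (h * D + E))                    ≡⟨ ∑-*ʳ curves (h * D + E) c ⟩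
        h * (h * D + E)                                        ∎

      -- In the correlation bound h D is the share of the mean and E the surplus. The cross terms 2
      -- N h ∑ J, the constant terms N D h² and the mean part of the second moment are all multiples
      -- of N h² D; they cancel exactly, leaving N h E.
      variance : ∑[ y ∈ points ] (excess y * excess y) ≤ N * (h * E)
      variance = +-cancelʳ-≤ (N * (h * (h * D)) + N * (h * (h * D))) _ _ (begin
        V + (N * (h * (h * D)) + N * (h * (h * D)))
          ≡⟨ cong (V +_) (cong (λ t → t + t) (begin-equality
            N * (h * (h * D))                    ≡⟨ cong (λ t → N * (h * t)) first ⟨
            N * (h * ∑ points J)                 ≡⟨ *-assoc N h _ ⟨
            N * h * ∑ points J                   ≡⟨ ∑-*ˡ points (N * h) J ⟨
            ∑[ y ∈ points ] (N * h * J y)        ≡⟨ ∑-cong points (λ y → solve 3 (λ n h j → n :* h :* j := n :* j :* h) refl N h (J y)) ⟩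
            ∑[ y ∈ points ] (N * J y * h)        ∎)) ⟩
        V + (∑[ y ∈ points ] (N * J y * h) + ∑[ y ∈ points ] (N * J y * h))
          ≡⟨ trans (∑-+ points _ _) (cong (V +_) (∑-+ points _ _)) ⟨
        ∑[ y ∈ points ] (excess y * excess y + (N * J y * h + N * J y * h))
          ≤⟨ ∑-mono points (λ y → [m∸n]²+2mn≤m²+n² (N * J y) h) ⟩
        ∑[ y ∈ points ] (N * J y * (N * J y) + h * h)
          ≡⟨ ∑-+ points _ _ ⟩
        ∑[ y ∈ points ] (N * J y * (N * J y)) + ∑[ _ ∈ points ] (h * h)
          ≡⟨ cong₂ _+_ (trans (∑-cong points λ y → solve 2 (λ n j → n :* j :* (n :* j) := n :* n :* (j :* j)) refl N (J y))
                              (∑-*ˡ points (N * N) _))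
                       (trans (∑-const points (h * h)) (cong (_* (h * h)) size)) ⟩
        N * N * ∑[ y ∈ points ] (J y * J y) + N * D * (h * h)
          ≡⟨ cong (_+ N * D * (h * h)) (*-assoc N N _) ⟩
        N * (N * ∑[ y ∈ points ] (J y * J y)) + N * D * (h * h)
          ≤⟨ +-monoˡ-≤ _ (*-monoʳ-≤ N second) ⟩
        N * (h * (h * D + E)) + N * D * (h * h)
          ≡⟨ solve 4 (λ n h d e → n :* (h :* (h :* d :+ e)) :+ n :* d :* (h :* h)
                               := n :* (h :* e) :+ (n :* (h :* (h :* d)) :+ n :* (h :* (h :* d)))) refl N h D E ⟩
        N * (h * E) + (N * (h * (h * D)) + N * (h * (h * D))) ∎)
        where V = ∑[ y ∈ points ] (excess y * excess y)

      squared : S * S ≤ ∑ points w * (N * (h * E))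
      squared = begin
        S * S                                                              ≤⟨ cauchySchwarz points w excess ⟩
        -- Cauchy-Schwarz squares the weights; for indicators w² ≤ w restores their plain total.
        ∑[ y ∈ points ] (w y * w y) * ∑[ y ∈ points ] (excess y * excess y) ≤⟨ *-mono-≤ (∑-mono points w²≤w) variance ⟩
        ∑ points w * (N * (h * E))                                         ∎

open FiniteSums

-- The ring solver with the coefficient (m , n) standing for the integer m − n;
-- the coefficients of an abstract ring itself would not cancel.
module IntegerRingSolver {a ℓ} (R : CommutativeRing a ℓ) where
  open CommutativeRing R hiding (zero; refl; sym; trans)
  private module R = CommutativeRing R
  open import Algebra.Properties.Semiring.Mult semiring renaming (_×_ to _×ᴿ_)
  open import Algebra.Properties.Ring ring
  open import Algebra.Properties.AbelianGroup +-abelianGroup using (⁻¹-∙-comm)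
  open import Algebra.Solver.Ring.AlmostCommutativeRing
  open import Algebra.Properties.CommutativeSemigroup +-commutativeSemigroup using (interchange)
  open import Relation.Binary.Reasoning.Setoid R.setoid

  private
    ⟪_⟫ : ℕ × ℕ → Carrier
    ⟪ m , n ⟫ = m ×ᴿ 1# - n ×ᴿ 1#

    -- One component of the result is always 0, so equal integers have identical representations and
    -- `coefficient≟` can compare componentwise.
    canonical : ℕ × ℕ → ℕ × ℕ
    canonical (m , n) = m ℕ.∸ n , n ℕ.∸ m

    coefficients : RawRing 0ℓ 0ℓ
    coefficients = record
      { Carrier = ℕ × ℕ
      ; _≈_     = _≡_
      ; _+_     = λ (m , n) (m′ , n′) → canonical (m ℕ.+ m′ , n ℕ.+ n′)
      ; _*_     = λ (m , n) (m′ , n′) → canonical (m ℕ.* m′ ℕ.+ n ℕ.* n′ , m ℕ.* n′ ℕ.+ n ℕ.* m′)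
      ; -_      = λ (m , n) → n , m
      ; 0#      = 0 , 0
      ; 1#      = 1 , 0
      }
    module C = RawRing coefficients

    ∸+-comm : ∀ m n → m ℕ.∸ n ℕ.+ n ≡ m ℕ.+ (n ℕ.∸ m)
    ∸+-comm zero    zero    = refl
    ∸+-comm zero    (suc n) = refl
    ∸+-comm (suc m) zero    = refl
    ∸+-comm (suc m) (suc n) = trans (ℕ.+-suc _ n) (cong suc (∸+-comm m n))

    canonical-≈ : ∀ p → ⟪ canonical p ⟫ ≈ ⟪ p ⟫
    canonical-≈ (m , n) = x∙y⁻¹≈ε⇒x≈y _ _ (begin
      ((m ℕ.∸ n) ×ᴿ 1# - (n ℕ.∸ m) ×ᴿ 1#) - (m ×ᴿ 1# - n ×ᴿ 1#)       ≈⟨ +-congˡ (⁻¹-anti-homo‿- _ _) ⟩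
      ((m ℕ.∸ n) ×ᴿ 1# - (n ℕ.∸ m) ×ᴿ 1#) + (n ×ᴿ 1# - m ×ᴿ 1#)       ≈⟨ interchange _ _ _ _ ⟩
      ((m ℕ.∸ n) ×ᴿ 1# + n ×ᴿ 1#) + (- ((n ℕ.∸ m) ×ᴿ 1#) - m ×ᴿ 1#)   ≈⟨ +-cong (×-homo-+ 1# (m ℕ.∸ n) n) (R.sym (⁻¹-∙-comm _ _)) ⟨
      (m ℕ.∸ n ℕ.+ n) ×ᴿ 1# - ((n ℕ.∸ m) ×ᴿ 1# + m ×ᴿ 1#)             ≈⟨ +-cong (×-congˡ (∸+-comm m n)) (-‿cong (+-comm _ _)) ⟩
      (m ℕ.+ (n ℕ.∸ m)) ×ᴿ 1# - (m ×ᴿ 1# + (n ℕ.∸ m) ×ᴿ 1#)           ≈⟨ +-congʳ (×-homo-+ 1# m (n ℕ.∸ m)) ⟩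
      (m ×ᴿ 1# + (n ℕ.∸ m) ×ᴿ 1#) - (m ×ᴿ 1# + (n ℕ.∸ m) ×ᴿ 1#)       ≈⟨ -‿inverseʳ _ ⟩
      0#                                                              ∎)

    +-homo : ∀ p q → ⟪ p C.+ q ⟫ ≈ ⟪ p ⟫ + ⟪ q ⟫
    +-homo (m , n) (m′ , n′) = begin
      ⟪ canonical (m ℕ.+ m′ , n ℕ.+ n′) ⟫                    ≈⟨ canonical-≈ (m ℕ.+ m′ , n ℕ.+ n′) ⟩
      (m ℕ.+ m′) ×ᴿ 1# - (n ℕ.+ n′) ×ᴿ 1#                    ≈⟨ +-cong (×-homo-+ 1# m m′) (-‿cong (×-homo-+ 1# n n′)) ⟩
      (m ×ᴿ 1# + m′ ×ᴿ 1#) - (n ×ᴿ 1# + n′ ×ᴿ 1#)            ≈⟨ +-congˡ (R.sym (⁻¹-∙-comm _ _)) ⟩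
      (m ×ᴿ 1# + m′ ×ᴿ 1#) + (- (n ×ᴿ 1#) - n′ ×ᴿ 1#)        ≈⟨ interchange _ _ _ _ ⟩
      ⟪ m , n ⟫ + ⟪ m′ , n′ ⟫ ∎

    -‿homo : ∀ p → ⟪ C.- p ⟫ ≈ - ⟪ p ⟫
    -‿homo (m , n) = begin
      n ×ᴿ 1# - m ×ᴿ 1#          ≈⟨ +-comm _ _ ⟩
      - (m ×ᴿ 1#) + n ×ᴿ 1#      ≈⟨ +-congˡ (-‿involutive _) ⟨
      - (m ×ᴿ 1#) - - (n ×ᴿ 1#)  ≈⟨ ⁻¹-∙-comm _ _ ⟩
      - ⟪ m , n ⟫                ∎

    *-homo : ∀ p q → ⟪ p C.* q ⟫ ≈ ⟪ p ⟫ * ⟪ q ⟫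
    *-homo (m , n) (m′ , n′) = begin
      ⟪ canonical (m ℕ.* m′ ℕ.+ n ℕ.* n′ , m ℕ.* n′ ℕ.+ n ℕ.* m′) ⟫
        ≈⟨ canonical-≈ (m ℕ.* m′ ℕ.+ n ℕ.* n′ , m ℕ.* n′ ℕ.+ n ℕ.* m′) ⟩
      (m ℕ.* m′ ℕ.+ n ℕ.* n′) ×ᴿ 1# - (m ℕ.* n′ ℕ.+ n ℕ.* m′) ×ᴿ 1#
        ≈⟨ +-cong (×-homo-+ 1# (m ℕ.* m′) _) (-‿cong (×-homo-+ 1# (m ℕ.* n′) _)) ⟩
      ((m ℕ.* m′) ×ᴿ 1# + (n ℕ.* n′) ×ᴿ 1#) - ((m ℕ.* n′) ×ᴿ 1# + (n ℕ.* m′) ×ᴿ 1#)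
        ≈⟨ +-cong (+-cong (×1-homo-* m m′) (×1-homo-* n n′)) (-‿cong (+-cong (×1-homo-* m n′) (×1-homo-* n m′))) ⟩
      (M * M′ + K * K′) - (M * K′ + K * M′)          ≈⟨ +-congˡ (⁻¹-∙-comm _ _) ⟨
      (M * M′ + K * K′) + (- (M * K′) - K * M′)      ≈⟨ +-congˡ (+-comm _ _) ⟩
      (M * M′ + K * K′) + (- (K * M′) - M * K′)      ≈⟨ interchange _ _ _ _ ⟩
      (M * M′ - K * M′) + (K * K′ - M * K′)          ≈⟨ +-congˡ (+-comm _ _) ⟩
      (M * M′ - K * M′) + (- (M * K′) + K * K′)      ≈⟨ +-cong ([y-z]x≈yx-zx M′ M K) (begin
          (M - K) * - K′              ≈⟨ distribʳ (- K′) M (- K) ⟩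
          M * - K′ + (- K) * - K′     ≈⟨ +-cong (-‿distribʳ-* M K′) (R.sym (begin
              - K * - K′      ≈⟨ -‿distribˡ-* K (- K′) ⟨
              - (K * - K′)    ≈⟨ -‿cong (-‿distribʳ-* K K′) ⟨
              - - (K * K′)    ≈⟨ -‿involutive _ ⟩
              K * K′          ∎)) ⟨
          - (M * K′) + K * K′ ∎) ⟨
      (M - K) * M′ + (M - K) * - K′                  ≈⟨ distribˡ (M - K) M′ (- K′) ⟨
      (M - K) * (M′ - K′)                            ∎
      where
      M = m ×ᴿ 1# ; M′ = m′ ×ᴿ 1# ; K = n ×ᴿ 1# ; K′ = n′ ×ᴿ 1#

    morphism : coefficients -Raw-AlmostCommutative⟶ fromCommutativeRing R
    morphism = record
      { ⟦_⟧    = ⟪_⟫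
      ; +-homo = +-homo
      ; *-homo = *-homo
      ; -‿homo = -‿homo
      ; 0-homo = -‿inverseʳ 0#
      ; 1-homo = R.trans (+-cong (+-identityʳ 1#) -0#≈0#) (+-identityʳ 1#)
      }

    coefficient≟ : ∀ p q → Maybe (⟪ p ⟫ ≈ ⟪ q ⟫)
    coefficient≟ (m , n) (m′ , n′) with m ℕ.≟ m′ | n ℕ.≟ n′
    ... | yes refl | yes refl = just (R.refl)
    ... | _        | _        = nothing

  open import Algebra.Solver.Ring coefficients (fromCommutativeRing R) morphism coefficient≟ public
    using (solve; _:=_; _:+_; _:*_; _:-_; :-_)


-- Enumerating and summing over vectors.

allᵇ : ∀ {x} {X : Set x} {m} → (X → Bool) → Vec X m → Bool
allᵇ p []       = true
allᵇ p (x ∷ xs) = p x ∧ allᵇ p xs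

module _ {x} {X : Set x} (xs : List X) where
  open import Data.Nat.Base using (_^_)

  vectors : ∀ m → List (Vec X m)
  vectors zero    = [] ∷ []
  vectors (suc m) = cartesianProductWith _∷_ xs (vectors m)

  ∑-vectors : ∀ {m} f → ∑ (vectors (suc m)) f ≡ ∑[ x ∈ xs ] ∑[ v ∈ vectors m ] f (x ∷ v)
  ∑-vectors f = ∑-cartesianProductWith _∷_ xs _ f

  ∑-allᵇ : ∀ p m → ∑[ v ∈ vectors m ] ⟦ allᵇ p v ⟧ ≡ ∑[ x ∈ xs ] ⟦ p x ⟧ ^ m
  ∑-allᵇ p zero    = refl
  ∑-allᵇ p (suc m) = begin
    ∑[ v ∈ vectors (suc m) ] ⟦ allᵇ p v ⟧                          ≡⟨ ∑-vectors _ ⟩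
    ∑[ x ∈ xs ] ∑[ v ∈ vectors m ] ⟦ p x ∧ allᵇ p v ⟧              ≡⟨ ∑-cong xs (λ x → ∑-cong (vectors m) λ v → ⟦∧⟧ (p x) (allᵇ p v)) ⟩
    ∑[ x ∈ xs ] ∑[ v ∈ vectors m ] (⟦ p x ⟧ ℕ.* ⟦ allᵇ p v ⟧)      ≡⟨ ∑-*-∑ xs (vectors m) _ _ ⟨
    ∑[ x ∈ xs ] ⟦ p x ⟧ ℕ.* ∑[ v ∈ vectors m ] ⟦ allᵇ p v ⟧        ≡⟨ cong (∑[ x ∈ xs ] ⟦ p x ⟧ ℕ.*_) (∑-allᵇ p m) ⟩
    ∑[ x ∈ xs ] ⟦ p x ⟧ ^ suc m                                    ∎
    where open ≡-Reasoning

  length-vectors : ∀ m → length (vectors m) ≡ length xs ^ m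
  length-vectors zero    = refl
  length-vectors (suc m) = begin
    length (vectors (suc m))                    ≡⟨ length-∑ (vectors (suc m)) ⟩
    ∑[ _ ∈ vectors (suc m) ] 1                  ≡⟨ ∑-vectors _ ⟩
    ∑[ _ ∈ xs ] ∑[ _ ∈ vectors m ] 1            ≡⟨ ∑-const xs _ ⟩
    length xs ℕ.* ∑[ _ ∈ vectors m ] 1          ≡⟨ cong (length xs ℕ.*_) (length-∑ (vectors m)) ⟨
    length xs ℕ.* length (vectors m)            ≡⟨ cong (length xs ℕ.*_) (length-vectors m) ⟩
    length xs ^ suc m                           ∎
    where
    open ≡-Reasoning
    length-∑ : ∀ {y} {Y : Set y} (ys : List Y) → length ys ≡ ∑[ _ ∈ ys ] 1
    length-∑ ys = sym (trans (∑-const ys 1) (ℕ.*-identityʳ _))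

does⇒≡ : ∀ {n} {x y : Fin n} → does (x ≟ y) ≡ true → x ≡ y
does⇒≡ {x = x} {y} = does-true (x ≟ y)

length-allFin : ∀ n → length (allFin n) ≡ n
length-allFin n = length-tabulate id

δ-≡ : ∀ {n} {x y : Fin n} → x ≡ y → δ x y ≡ 1
δ-≡ {x = x} refl = δ-refl x

-- Spheres over a finite local ring on `Fin N`: common points and square roots.

module Core {N : ℕ} {add mul : Op₂ (Fin N)} {neg : Op₁ (Fin N)} {zero# one# : Fin N}
            (isCommutativeRing : IsCommutativeRing _≡_ add mul neg zero# one#) where

  ring : CommutativeRing 0ℓ 0ℓ
  ring = record { isCommutativeRing = isCommutativeRing }

  open import Data.Nat.Base using (_^_)
  private
    module R = CommutativeRing ring
  open R using (_+_; _*_; _-_; -_; 0#; 1#)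
  open IntegerRingSolver ring
  open import Algebra.Properties.Ring R.ring using (+-cancelˡ; +-cancelʳ; -‿injective; x∙y⁻¹≈ε⇒x≈y; x≈y⇒x∙y⁻¹≈ε)

  all : List (Fin N)
  all = allFin N

  Unit : Fin N → Set
  Unit x = ∃ λ y → x * y ≡ 1#

  unit-cancel : ∀ {x y} → Unit x → x * y ≡ 0# → y ≡ 0#
  unit-cancel {x} {y} (x⁻¹ , x*x⁻¹≡1) x*y≡0 = begin
    y                ≡⟨ R.*-identityˡ y ⟨
    1# * y           ≡⟨ cong (_* y) x*x⁻¹≡1 ⟨
    x * x⁻¹ * y      ≡⟨ solve 3 (λ x i y → x :* i :* y := i :* (x :* y)) refl x x⁻¹ y ⟩
    x⁻¹ * (x * y)    ≡⟨ cong (x⁻¹ *_) x*y≡0 ⟩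
    x⁻¹ * 0#         ≡⟨ R.zeroʳ x⁻¹ ⟩
    0#               ∎
    where open ≡-Reasoning

  normSq : ∀ {m} → Vec (Fin N) m → Fin N
  normSq []       = 0#
  normSq (x ∷ xs) = x * x + normSq xs

  distSq : ∀ {m} → Vec (Fin N) m → Vec (Fin N) m → Fin N
  distSq []       []       = 0#
  distSq (a ∷ as) (b ∷ bs) = (b - a) * (b - a) + distSq as bs

  distSq-shift : ∀ {m} (as bs : Vec (Fin N) m) → distSq as (zipWith _+_ as bs) ≡ normSq bs
  distSq-shift []       []       = refl
  distSq-shift (a ∷ as) (b ∷ bs) = cong₂ _+_
    (solve 2 (λ a b → (a :+ b :- a) :* (a :+ b :- a) := b :* b) refl a b) (distSq-shift as bs)

  ∑-shift : ∀ {m} (as : Vec (Fin N) m) f →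
            ∑[ bs ∈ vectors all m ] f (zipWith _+_ as bs) ≤ ∑ (vectors all m) f
  ∑-shift []       f = ℕ.≤-refl
  ∑-shift {suc m} (a ∷ as) f = begin
    ∑[ bs ∈ vectors all (suc m) ] f (zipWith _+_ (a ∷ as) bs)               ≡⟨ ∑-vectors all _ ⟩
    ∑[ b ∈ all ] ∑[ bs ∈ vectors all m ] f ((a + b) ∷ zipWith _+_ as bs)    ≤⟨ ∑-mono all (λ b → ∑-shift as (λ v → f ((a + b) ∷ v))) ⟩
    ∑[ b ∈ all ] ∑[ bs ∈ vectors all m ] f ((a + b) ∷ bs)                   ≤⟨ ∑-injective (a +_) (+-cancelˡ a _ _) (λ b → ∑[ bs ∈ vectors all m ] f (b ∷ bs)) ⟩
    ∑[ b ∈ all ] ∑[ bs ∈ vectors all m ] f (b ∷ bs)                         ≡⟨ ∑-vectors all f ⟨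
    ∑ (vectors all (suc m)) f                                               ∎
    where open ℕ.≤-Reasoning

  -- The parameters are all that the estimates know of the valuation ring. The family `nonunit` is a
  -- covering list, since only an upper bound on the number of nonunits enters; `unit-+` expresses
  -- locality.
  module Local (w : ℕ) (nonunit : Fin w → Fin N)
               (unit? : ∀ x → Unit x ⊎ ∃ λ j → nonunit j ≡ x)
               (unit-+ : ∀ {x y} → Unit (x + y) → Unit x ⊎ Unit y)
               (unit-2 : Unit (1# + 1#)) where

    unitᵇ : Fin N → Bool
    unitᵇ x with unit? x
    ... | inj₁ _ = true
    ... | inj₂ _ = false

    unitᵇ⇒Unit : ∀ {x} → unitᵇ x ≡ true → Unit x
    unitᵇ⇒Unit {x} e with unit? x
    ... | inj₁ u = u

    ν : Fin N → ℕ
    ν x = ⟦ not (unitᵇ x) ⟧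

    ∑-ν : ∑ all ν ≤ w
    ∑-ν = begin
      ∑ all ν                                                 ≤⟨ ∑-mono all bound ⟩
      ∑[ x ∈ all ] ∑[ j ∈ allFin w ] δ x (nonunit j)          ≡⟨ ∑-comm all (allFin w) _ ⟩
      ∑[ j ∈ allFin w ] ∑[ x ∈ all ] δ x (nonunit j)          ≡⟨ ∑-cong (allFin w) (λ j → ∑-δ₁ (nonunit j)) ⟩
      ∑[ j ∈ allFin w ] 1                                     ≡⟨ trans (∑-const (allFin w) 1) (ℕ.*-identityʳ _) ⟩
      length (allFin w)                                       ≡⟨ length-allFin w ⟩
      w                                                       ∎
      where
      open ℕ.≤-Reasoning
      bound : ∀ x → ν x ≤ ∑[ j ∈ allFin w ] δ x (nonunit j)
      bound x with unit? x
      ... | inj₁ _          = z≤n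
      ... | inj₂ (j , refl) = begin
        1                                                     ≡⟨ ∑-δ₁ j ⟨
        ∑[ i ∈ allFin w ] δ i j                               ≤⟨ ∑-mono (allFin w) mono ⟩
        ∑[ i ∈ allFin w ] δ (nonunit j) (nonunit i)           ∎
        where
        mono : ∀ i → δ i j ≤ δ (nonunit j) (nonunit i)
        mono i with i ≟ j
        ... | yes refl = ℕ.≤-reflexive (sym (δ-refl (nonunit i)))
        ... | no _     = z≤n

    -- The indicator of congruence modulo the maximal ideal: 1 when no coordinate difference is a
    -- unit, 0 otherwise.
    νᵛ : ∀ {m} → Vec (Fin N) m → Vec (Fin N) m → ℕ
    νᵛ []       []       = 1
    νᵛ (a ∷ as) (b ∷ bs) = ν (a - b) ℕ.* νᵛ as bs

    ∑-νᵛ : ∀ {m} (as : Vec (Fin N) m) → ∑ (vectors all m) (νᵛ as) ≤ w ^ m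
    ∑-νᵛ []               = ℕ.≤-refl
    ∑-νᵛ {suc m} (a ∷ as) = begin
      ∑ (vectors all (suc m)) (νᵛ (a ∷ as))                             ≡⟨ ∑-vectors all _ ⟩
      ∑[ b ∈ all ] ∑[ bs ∈ vectors all m ] (ν (a - b) ℕ.* νᵛ as bs)     ≡⟨ ∑-*-∑ all (vectors all m) _ _ ⟨
      ∑[ b ∈ all ] ν (a - b) ℕ.* ∑ (vectors all m) (νᵛ as)              ≤⟨ ℕ.*-mono-≤ (ℕ.≤-trans (∑-injective (λ x → a - x) (-‿injective ∘ +-cancelˡ a _ _) ν) ∑-ν) (∑-νᵛ as) ⟩
      w ℕ.* w ^ m                                                       ∎
      where open ℕ.≤-Reasoning

    double-cancel : ∀ {x} → x + x ≡ 0# → x ≡ 0#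
    double-cancel {x} e = unit-cancel unit-2 (begin
      (1# + 1#) * x      ≡⟨ R.distribʳ x 1# 1# ⟩
      1# * x + 1# * x    ≡⟨ cong₂ _+_ (R.*-identityˡ x) (R.*-identityˡ x) ⟩
      x + x              ≡⟨ e ⟩
      0#                 ∎)
      where open ≡-Reasoning

    -- Subtracting the two equations leaves 2 (a − a′) (b − c) = 0.
    equidistant-unique : ∀ {a a′ s s′ d d′ b c} → Unit (a - a′) →
      s + ((b - a) * (b - a) + d) ≡ s′ + ((b - a′) * (b - a′) + d′) →
      s + ((c - a) * (c - a) + d) ≡ s′ + ((c - a′) * (c - a′) + d′) →
      b ≡ c
    equidistant-unique {a} {a′} {s} {s′} {d} {d′} {b} {c} unit eb ec =
      x∙y⁻¹≈ε⇒x≈y b c (unit-cancel unit (double-cancel (begin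
        (a - a′) * (b - c) + (a - a′) * (b - c)
          ≡⟨ solve 8 (λ a a′ s s′ d d′ b c → (a :- a′) :* (b :- c) :+ (a :- a′) :* (b :- c)
               := ((s′ :+ ((b :- a′) :* (b :- a′) :+ d′)) :- (s :+ ((b :- a) :* (b :- a) :+ d)))
                  :- ((s′ :+ ((c :- a′) :* (c :- a′) :+ d′)) :- (s :+ ((c :- a) :* (c :- a) :+ d))))
               refl a a′ s s′ d d′ b c ⟩
        (Rb - Lb) - (Rc - Lc)        ≡⟨ cong₂ (λ x y → x - y) (x≈y⇒x∙y⁻¹≈ε (sym eb)) (x≈y⇒x∙y⁻¹≈ε (sym ec)) ⟩
        0# - 0#                      ≡⟨ R.-‿inverseʳ 0# ⟩
        0#                           ∎)))
      where
      open ≡-Reasoning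
      Lb = s + ((b - a) * (b - a) + d)
      Rb = s′ + ((b - a′) * (b - a′) + d′)
      Lc = s + ((c - a) * (c - a) + d)
      Rc = s′ + ((c - a′) * (c - a′) + d′)

    -- Counts the common points of two spheres after eliminating t, which each sphere determines
    -- from b. The arguments s and s′ stand for x² and x′², but stay arbitrary so that the terms of
    -- earlier coordinates can be moved into them.
    equidistant : ∀ {m} (as as′ : Vec (Fin N) m) → Fin N → Fin N → ℕ
    equidistant {m} as as′ s s′ = ∑[ b ∈ vectors all m ] δ (s + distSq as b) (s′ + distSq as′ b)

    -- At the first coordinate where the centres differ by a unit, the remaining coordinates of b
    -- determine that one, which saves a factor N. Coordinates before it are summed freely, their
    -- terms passing into s and s′; hence the bound must be uniform in s and s′. Multiplying by N
    -- avoids the exponent m - 1.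
    equidistant-bound : ∀ {m} (as as′ : Vec (Fin N) m) →
      νᵛ as as′ ≡ 1 ⊎ (∀ s s′ → N ℕ.* equidistant as as′ s s′ ≤ N ^ m)
    equidistant-bound []       []         = inj₁ refl
    equidistant-bound {suc m} (a ∷ as) (a′ ∷ as′) with unitᵇ (a - a′) in isUnit
    ... | true  = inj₂ λ s s′ → begin
      N ℕ.* equidistant (a ∷ as) (a′ ∷ as′) s s′
        ≡⟨ cong (N ℕ.*_) (trans (∑-vectors all _) (∑-comm all (vectors all m) _)) ⟩
      N ℕ.* ∑[ bs ∈ vectors all m ] ∑[ b ∈ all ] _
        ≤⟨ ℕ.*-monoʳ-≤ N (∑-mono (vectors all m) λ bs → ∑-atMostOne
             (λ b → does ((s + distSq (a ∷ as) (b ∷ bs)) ≟ (s′ + distSq (a′ ∷ as′) (b ∷ bs))))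
             λ eb ec → equidistant-unique (unitᵇ⇒Unit isUnit) (does⇒≡ eb) (does⇒≡ ec)) ⟩
      N ℕ.* ∑[ _ ∈ vectors all m ] 1
        ≡⟨ cong (N ℕ.*_) (trans (∑-const (vectors all m) 1) (trans (ℕ.*-identityʳ _)
             (trans (length-vectors all m) (cong (_^ m) (length-allFin N))))) ⟩
      N ^ suc m ∎
      where open ℕ.≤-Reasoning
    ... | false with equidistant-bound as as′
    ...   | inj₁ ν≡1   = inj₁ (trans (ℕ.*-identityˡ _) ν≡1)
    ...   | inj₂ bound = inj₂ λ s s′ → begin
      N ℕ.* equidistant (a ∷ as) (a′ ∷ as′) s s′
        ≡⟨ cong (N ℕ.*_) (trans (∑-vectors all _) (∑-cong all λ b → ∑-cong (vectors all m) λ bs →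
             cong₂ δ (sym (R.+-assoc s _ _)) (sym (R.+-assoc s′ _ _)))) ⟩
      N ℕ.* ∑[ b ∈ all ] equidistant as as′ (s + (b - a) * (b - a)) (s′ + (b - a′) * (b - a′))
        ≡⟨ ∑-*ˡ all N _ ⟨
      ∑[ b ∈ all ] (N ℕ.* equidistant as as′ (s + (b - a) * (b - a)) (s′ + (b - a′) * (b - a′)))
        ≤⟨ ∑-mono all (λ b → bound _ _) ⟩
      ∑[ _ ∈ all ] (N ^ m)
        ≡⟨ trans (∑-const all (N ^ m)) (cong (ℕ._* N ^ m) (length-allFin N)) ⟩
      N ^ suc m ∎
      where open ℕ.≤-Reasoning

    -- (x − y) (x + y) = 0, and one factor is a unit because their sum 2 x is.
    squares-unit : ∀ {x y} → Unit x → x * x ≡ y * y → x ≡ y ⊎ x ≡ - y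
    squares-unit {x} {y} (x⁻¹ , x*x⁻¹≡1) e = Sum.map
      (λ u → x∙y⁻¹≈ε⇒x≈y x y (unit-cancel u
        (trans (solve 2 (λ x y → (x :+ y) :* (x :- y) := x :* x :- y :* y) refl x y) (x≈y⇒x∙y⁻¹≈ε e))))
      (λ u → x∙y⁻¹≈ε⇒x≈y x (- y) (trans (solve 2 (λ x y → x :- :- y := x :+ y) refl x y) (unit-cancel u
        (trans (solve 2 (λ x y → (x :- y) :* (x :+ y) := x :* x :- y :* y) refl x y) (x≈y⇒x∙y⁻¹≈ε e)))))
      (unit-+ sum-unit)
      where
      open ≡-Reasoning
      ½ = proj₁ unit-2
      sum-unit : Unit ((x + y) + (x - y))
      sum-unit = x⁻¹ * ½ , (begin
        ((x + y) + (x - y)) * (x⁻¹ * ½)  ≡⟨ solve 4 (λ x y i h → ((x :+ y) :+ (x :- y)) :* (i :* h) := (x :* i) :* h :+ (x :* i) :* h) refl x y x⁻¹ ½ ⟩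
        x * x⁻¹ * ½ + x * x⁻¹ * ½        ≡⟨ cong (λ t → t * ½ + t * ½) x*x⁻¹≡1 ⟩
        1# * ½ + 1# * ½                  ≡⟨ R.distribʳ ½ 1# 1# ⟨
        (1# + 1#) * ½                    ≡⟨ proj₂ unit-2 ⟩
        1#                               ∎)

    -- Once one unit root x₀ is known, `squares-unit` leaves only x₀ and - x₀.
    unitRoots≤2 : ∀ s e → ∑[ x ∈ all ] (⟦ unitᵇ x ⟧ ℕ.* δ s (x * x + e)) ≤ 2
    unitRoots≤2 s e with any? (λ x → (unitᵇ x Bool.≟ true) ×-dec (s ≟ (x * x + e)))
    ... | yes (x₀ , _ , s≡) = begin
      ∑[ x ∈ all ] (⟦ unitᵇ x ⟧ ℕ.* δ s (x * x + e))        ≤⟨ ∑-mono all bound ⟩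
      ∑[ x ∈ all ] (δ x x₀ ℕ.+ δ x (- x₀))                  ≡⟨ ∑-+ all _ _ ⟩
      ∑[ x ∈ all ] δ x x₀ ℕ.+ ∑[ x ∈ all ] δ x (- x₀)       ≡⟨ cong₂ ℕ._+_ (∑-δ₁ x₀) (∑-δ₁ (- x₀)) ⟩
      2                                                     ∎
      where
      open ℕ.≤-Reasoning
      bound : ∀ x → ⟦ unitᵇ x ⟧ ℕ.* δ s (x * x + e) ≤ δ x x₀ ℕ.+ δ x (- x₀)
      bound x with unitᵇ x in isUnit | s ≟ (x * x + e)
      ... | false | _     = z≤n
      ... | true  | no _  = z≤n
      ... | true  | yes s≡′ = Sum.[ (λ x≡ → ℕ.≤-trans (ℕ.≤-reflexive (sym (δ-≡ x≡))) (ℕ.m≤m+n _ _))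
                                  , (λ x≡ → ℕ.≤-trans (ℕ.≤-reflexive (sym (δ-≡ x≡))) (ℕ.m≤n+m _ _))
                                  ]′ (squares-unit (unitᵇ⇒Unit isUnit) (+-cancelʳ e _ _ (trans (sym s≡′) s≡)))
    ... | no ∄x = ℕ.≤-trans (∑-mono all {g = λ _ → 0} bound)
                    (ℕ.≤-trans (ℕ.≤-reflexive (trans (∑-const all 0) (ℕ.*-zeroʳ (length all)))) z≤n)
      where
      bound : ∀ x → ⟦ unitᵇ x ⟧ ℕ.* δ s (x * x + e) ≤ 0
      bound x with unitᵇ x in isUnit | s ≟ (x * x + e)
      ... | false | _      = z≤n
      ... | true  | no _   = z≤n
      ... | true  | yes s≡ = contradiction (x , isUnit , s≡) ∄x

    -- Incidences between spheres centred in Aᵐ and the points of Bᵐ × T.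

    module _ (A B T : Fin N → Bool) (m : ℕ)
             (A+A⊆B : ∀ {x y} → A x ≡ true → A y ≡ true → B (x + y) ≡ true)
             (normSq∈T : ∀ (v : Vec (Fin N) (suc m)) → allᵇ A v ≡ true → T (normSq v) ≡ true) where

      private
        vecs : List (Vec (Fin N) m)
        vecs = vectors all m

        pairs : List (Vec (Fin N) m × Fin N)
        pairs = cartesianProductWith _,_ vecs all

        ∑-pairs : ∀ f → ∑ pairs f ≡ ∑[ v ∈ vecs ] ∑[ x ∈ all ] f (v , x)
        ∑-pairs f = ∑-cartesianProductWith _,_ vecs all f

        length-vecs : length vecs ≡ N ^ m
        length-vecs = trans (length-vectors all m) (cong (_^ m) (length-allFin N))

        α β τ υ : ℕ
        α = ∑[ x ∈ all ] ⟦ A x ⟧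
        β = ∑[ x ∈ all ] ⟦ B x ⟧
        τ = ∑[ x ∈ all ] ⟦ T x ⟧
        υ = ∑[ x ∈ all ] ⟦ A x ∧ unitᵇ x ⟧

        c weight : Vec (Fin N) m × Fin N → ℕ
        c      (a , x) = ⟦ allᵇ A a ⟧ ℕ.* ⟦ A x ∧ unitᵇ x ⟧
        weight (b , t) = ⟦ allᵇ B b ⟧ ℕ.* ⟦ T t ⟧

        ι : Vec (Fin N) m × Fin N → Vec (Fin N) m × Fin N → ℕ
        ι (a , x) (b , t) = δ (x * x + distSq a b) t

        ∑-product : ∀ (f : Vec (Fin N) m → ℕ) (g : Fin N → ℕ) →
                    ∑[ p ∈ pairs ] (f (proj₁ p) ℕ.* g (proj₂ p)) ≡ ∑ vecs f ℕ.* ∑ all g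
        ∑-product f g = trans (∑-pairs _) (sym (∑-*-∑ vecs all f g))

        ∑-c : ∑ pairs c ≡ α ^ m ℕ.* υ
        ∑-c = trans (∑-product _ _) (cong (ℕ._* υ) (∑-allᵇ all A m))

        ∑-weight : ∑ pairs weight ≡ β ^ m ℕ.* τ
        ∑-weight = trans (∑-product _ _) (cong (ℕ._* τ) (∑-allᵇ all B m))

        degree : ∀ x → ∑ pairs (ι x) ≡ N ^ m
        degree (a , x) = begin
          ∑ pairs (ι (a , x))                                       ≡⟨ ∑-pairs _ ⟩
          ∑[ b ∈ vecs ] ∑[ t ∈ all ] δ (x * x + distSq a b) t       ≡⟨ ∑-cong vecs (λ b → ∑-δ₁ʳ (x * x + distSq a b)) ⟩
          ∑[ _ ∈ vecs ] 1                                           ≡⟨ trans (∑-const vecs 1) (ℕ.*-identityʳ _) ⟩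
          length vecs                                               ≡⟨ length-vecs ⟩
          N ^ m                                                     ∎
          where open ≡-Reasoning

        size : length pairs ≡ N ℕ.* N ^ m
        size = begin
          length pairs                          ≡⟨ trans (∑-const pairs 1) (ℕ.*-identityʳ _) ⟨
          ∑[ _ ∈ pairs ] 1                      ≡⟨ ∑-pairs _ ⟩
          ∑[ _ ∈ vecs ] ∑[ _ ∈ all ] 1          ≡⟨ ∑-const vecs _ ⟩
          length vecs ℕ.* ∑[ _ ∈ all ] 1        ≡⟨ cong₂ ℕ._*_ length-vecs (trans (∑-const all 1) (trans (ℕ.*-identityʳ _) (length-allFin N))) ⟩
          N ^ m ℕ.* N                           ≡⟨ ℕ.*-comm (N ^ m) N ⟩
          N ℕ.* N ^ m                           ∎
          where open ≡-Reasoning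

        -- The first sphere fixes t, so the sum over t leaves a condition on b alone. The two
        -- centres come out in reversed order; `δ-sym` restores the order where `equidistant-bound`
        -- is applied.
        common : ∀ a x a′ x′ → ∑[ p ∈ pairs ] (ι (a , x) p ℕ.* ι (a′ , x′) p) ≡ equidistant a′ a (x′ * x′) (x * x)
        common a x a′ x′ = begin
          ∑[ p ∈ pairs ] (ι (a , x) p ℕ.* ι (a′ , x′) p)
            ≡⟨ ∑-pairs _ ⟩
          ∑[ b ∈ vecs ] ∑[ t ∈ all ] (δ (x * x + distSq a b) t ℕ.* δ (x′ * x′ + distSq a′ b) t)
            ≡⟨ ∑-cong vecs (λ b → trans (∑-cong all λ t → cong (ℕ._* _) (δ-sym (x * x + distSq a b) t)) (∑-δ _ (x * x + distSq a b))) ⟩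
          equidistant a′ a (x′ * x′) (x * x) ∎
          where open ≡-Reasoning

        -- The surplus allowed to one sphere, carrying the factor N of the correlations: at most wᵐ
        -- congruent centres, N^m choices of b for each, and 2 unit roots x′ for each b.
        E : ℕ
        E = w ^ m ℕ.* (N ℕ.* (N ^ m ℕ.* 2))

        -- Centres a, a′ that agree modulo the nonunits share too many points;
        -- for these, x′² is determined by a, x, a′ and the point.
        congruent : ∀ a x → ∑[ q ∈ pairs ] (νᵛ a (proj₁ q) ℕ.* (N ℕ.* (c q ℕ.* equidistant (proj₁ q) a (proj₂ q * proj₂ q) (x * x)))) ≤ E
        congruent a x = begin
          ∑[ q ∈ pairs ] (νᵛ a (proj₁ q) ℕ.* (N ℕ.* (c q ℕ.* equidistant (proj₁ q) a (proj₂ q * proj₂ q) (x * x))))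
            ≡⟨ ∑-pairs _ ⟩
          ∑[ a′ ∈ vecs ] ∑[ x′ ∈ all ] (νᵛ a a′ ℕ.* (N ℕ.* (c (a′ , x′) ℕ.* equidistant a′ a (x′ * x′) (x * x))))
            ≡⟨ ∑-cong vecs (λ a′ → trans (∑-*ˡ all (νᵛ a a′) _) (cong (νᵛ a a′ ℕ.*_) (∑-*ˡ all N _))) ⟩
          ∑[ a′ ∈ vecs ] (νᵛ a a′ ℕ.* (N ℕ.* ∑[ x′ ∈ all ] (c (a′ , x′) ℕ.* equidistant a′ a (x′ * x′) (x * x))))
            ≤⟨ ∑-mono vecs (λ a′ → ℕ.*-monoʳ-≤ (νᵛ a a′) (ℕ.*-monoʳ-≤ N (roots a′))) ⟩
          ∑[ a′ ∈ vecs ] (νᵛ a a′ ℕ.* (N ℕ.* (N ^ m ℕ.* 2)))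
            ≡⟨ ∑-*ʳ vecs _ (νᵛ a) ⟩
          ∑ vecs (νᵛ a) ℕ.* (N ℕ.* (N ^ m ℕ.* 2))
            ≤⟨ ℕ.*-monoˡ-≤ _ (∑-νᵛ a) ⟩
          E ∎
          where
          open ℕ.≤-Reasoning
          c≤unit : ∀ a′ x′ → c (a′ , x′) ≤ ⟦ unitᵇ x′ ⟧
          c≤unit a′ x′ with allᵇ A a′ | A x′ | unitᵇ x′
          ... | true  | true  | true  = ℕ.≤-refl
          ... | true  | true  | false = z≤n
          ... | true  | false | _     = z≤n
          ... | false | _     | _     = z≤n
          roots : ∀ a′ → ∑[ x′ ∈ all ] (c (a′ , x′) ℕ.* equidistant a′ a (x′ * x′) (x * x)) ≤ N ^ m ℕ.* 2
          roots a′ = begin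
            ∑[ x′ ∈ all ] (c (a′ , x′) ℕ.* equidistant a′ a (x′ * x′) (x * x))
              ≤⟨ ∑-mono all (λ x′ → ℕ.*-monoˡ-≤ (equidistant a′ a (x′ * x′) (x * x)) (c≤unit a′ x′)) ⟩
            ∑[ x′ ∈ all ] (⟦ unitᵇ x′ ⟧ ℕ.* equidistant a′ a (x′ * x′) (x * x))
              ≡⟨ ∑-cong all (λ x′ → sym (∑-*ˡ vecs ⟦ unitᵇ x′ ⟧ _)) ⟩
            ∑[ x′ ∈ all ] ∑[ b ∈ vecs ] (⟦ unitᵇ x′ ⟧ ℕ.* δ (x′ * x′ + distSq a′ b) (x * x + distSq a b))
              ≡⟨ ∑-comm all vecs _ ⟩
            ∑[ b ∈ vecs ] ∑[ x′ ∈ all ] (⟦ unitᵇ x′ ⟧ ℕ.* δ (x′ * x′ + distSq a′ b) (x * x + distSq a b))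
              ≡⟨ ∑-cong vecs (λ b → ∑-cong all λ x′ → cong (⟦ unitᵇ x′ ⟧ ℕ.*_) (δ-sym (x′ * x′ + distSq a′ b) (x * x + distSq a b))) ⟩
            ∑[ b ∈ vecs ] ∑[ x′ ∈ all ] (⟦ unitᵇ x′ ⟧ ℕ.* δ (x * x + distSq a b) (x′ * x′ + distSq a′ b))
              ≤⟨ ∑-mono vecs (λ b → unitRoots≤2 (x * x + distSq a b) (distSq a′ b)) ⟩
            ∑[ _ ∈ vecs ] 2
              ≡⟨ trans (∑-const vecs 2) (cong (ℕ._* 2) length-vecs) ⟩
            N ^ m ℕ.* 2 ∎

        -- Each pair is paid for by one of two terms: the mean share c · N^m if some coordinate
        -- difference is a unit, its own full contribution if `νᵛ` is 1. Adding both terms for every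
        -- pair avoids splitting the sum.
        correlation : ∀ q → N ℕ.* ∑[ q′ ∈ pairs ] (c q′ ℕ.* ∑[ p ∈ pairs ] (ι q p ℕ.* ι q′ p)) ≤ ∑ pairs c ℕ.* N ^ m ℕ.+ E
        correlation (a , x) = begin
          N ℕ.* ∑[ q′ ∈ pairs ] (c q′ ℕ.* ∑[ p ∈ pairs ] (ι (a , x) p ℕ.* ι q′ p))
            ≡⟨ ∑-*ˡ pairs N _ ⟨
          ∑[ q′ ∈ pairs ] (N ℕ.* (c q′ ℕ.* ∑[ p ∈ pairs ] (ι (a , x) p ℕ.* ι q′ p)))
            ≡⟨ ∑-cong pairs (λ (a′ , x′) → cong (λ t → N ℕ.* (c (a′ , x′) ℕ.* t)) (common a x a′ x′)) ⟩
          ∑[ q′ ∈ pairs ] (N ℕ.* (c q′ ℕ.* K q′))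
            ≤⟨ ∑-mono pairs bound ⟩
          ∑[ q′ ∈ pairs ] (c q′ ℕ.* N ^ m ℕ.+ νᵛ a (proj₁ q′) ℕ.* (N ℕ.* (c q′ ℕ.* K q′)))
            ≡⟨ ∑-+ pairs _ _ ⟩
          ∑[ q′ ∈ pairs ] (c q′ ℕ.* N ^ m) ℕ.+ ∑[ q′ ∈ pairs ] (νᵛ a (proj₁ q′) ℕ.* (N ℕ.* (c q′ ℕ.* K q′)))
            ≤⟨ ℕ.+-mono-≤ (ℕ.≤-reflexive (∑-*ʳ pairs (N ^ m) c)) (congruent a x) ⟩
          ∑ pairs c ℕ.* N ^ m ℕ.+ E ∎
          where
          open ℕ.≤-Reasoning
          K : Vec (Fin N) m × Fin N → ℕ
          K (a′ , x′) = equidistant a′ a (x′ * x′) (x * x)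
          bound : ∀ q′ → N ℕ.* (c q′ ℕ.* K q′) ≤ c q′ ℕ.* N ^ m ℕ.+ νᵛ a (proj₁ q′) ℕ.* (N ℕ.* (c q′ ℕ.* K q′))
          bound q′@(a′ , x′) = Sum.[ close , far ]′ (equidistant-bound a a′)
            where
            module S = +-*-Solver
            X = N ℕ.* (c q′ ℕ.* K q′)
            close : νᵛ a a′ ≡ 1 → X ≤ c q′ ℕ.* N ^ m ℕ.+ νᵛ a a′ ℕ.* X
            close ν≡1 = ℕ.≤-trans (ℕ.≤-reflexive (trans (sym (ℕ.*-identityˡ _)) (cong (ℕ._* X) (sym ν≡1)))) (ℕ.m≤n+m _ _)
            far : (∀ s s′ → N ℕ.* equidistant a a′ s s′ ≤ N ^ m) → X ≤ c q′ ℕ.* N ^ m ℕ.+ νᵛ a a′ ℕ.* X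
            far few = ℕ.≤-trans (begin
              N ℕ.* (c q′ ℕ.* K q′)                                    ≡⟨ cong (λ t → N ℕ.* (c q′ ℕ.* t)) (∑-cong vecs λ b → δ-sym (x′ * x′ + distSq a′ b) (x * x + distSq a b)) ⟩
              N ℕ.* (c q′ ℕ.* equidistant a a′ (x * x) (x′ * x′))      ≡⟨ S.solve 3 (λ n c k → n S.:* (c S.:* k) S.:= c S.:* (n S.:* k)) refl N (c q′) _ ⟩
              c q′ ℕ.* (N ℕ.* equidistant a a′ (x * x) (x′ * x′))      ≤⟨ ℕ.*-monoʳ-≤ (c q′) (few _ _) ⟩
              c q′ ℕ.* N ^ m                                           ∎) (ℕ.m≤m+n _ _)

        allᵇ-shift : ∀ {k} (a b : Vec (Fin N) k) → allᵇ A a ≡ true → allᵇ A b ≡ true → allᵇ B (zipWith _+_ a b) ≡ true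
        allᵇ-shift []       []       _  _  = refl
        allᵇ-shift (x ∷ a) (y ∷ b) ea eb with A x in ex | A y in ey
        ... | true | true rewrite A+A⊆B ex ey = allᵇ-shift a b ea eb

        -- The factor `c q` on both sides makes the claim trivial for pairs outside the family of
        -- spheres. Inside it, `∑-shift` ensures that different a′ give different points a + a′.
        rich : ∀ q → c q ℕ.* α ^ m ≤ c q ℕ.* ∑[ p ∈ pairs ] (weight p ℕ.* ι q p)
        rich (a , x) with allᵇ A a in ea | A x in ex | unitᵇ x
        ... | false | _     | _     = z≤n
        ... | true  | false | _     = z≤n
        ... | true  | true  | false = z≤n
        ... | true  | true  | true  = ℕ.*-monoʳ-≤ 1 (begin
          α ^ m
            ≡⟨ ∑-allᵇ all A m ⟨
          ∑[ a′ ∈ vecs ] ⟦ allᵇ A a′ ⟧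
            ≤⟨ ∑-mono vecs inside ⟩
          ∑[ a′ ∈ vecs ] F (zipWith _+_ a a′)
            ≤⟨ ∑-shift a F ⟩
          ∑ vecs F
            ≡⟨ ∑-cong vecs (λ b → trans (∑-cong all λ t → cong (ℕ._* weight (b , t)) (δ-sym t (x * x + distSq a b)))
                 (∑-cong all λ t → ℕ.*-comm (δ (x * x + distSq a b) t) (weight (b , t)))) ⟩
          ∑[ b ∈ vecs ] ∑[ t ∈ all ] (weight (b , t) ℕ.* ι (a , x) (b , t))
            ≡⟨ ∑-pairs _ ⟨
          ∑[ p ∈ pairs ] (weight p ℕ.* ι (a , x) p) ∎)
          where
          open ℕ.≤-Reasoning
          F : Vec (Fin N) m → ℕ
          F b = ∑[ t ∈ all ] (δ t (x * x + distSq a b) ℕ.* weight (b , t))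
          inside : ∀ a′ → ⟦ allᵇ A a′ ⟧ ≤ F (zipWith _+_ a a′)
          inside a′ with allᵇ A a′ in ea′
          ... | false = z≤n
          ... | true  = ℕ.≤-reflexive (sym (trans (∑-δ _ (x * x + distSq a (zipWith _+_ a a′)))
            (cong₂ (λ s t → ⟦ s ⟧ ℕ.* ⟦ t ⟧) (allᵇ-shift a a′ ea ea′)
              (trans (cong (λ d → T (x * x + d)) (distSq-shift a a′)) (normSq∈T (x ∷ a′) (trans (cong (_∧ allᵇ A a′) ex) ea′))))))

        incidences-≥ : ∑ pairs c ℕ.* α ^ m ≤ ∑[ p ∈ pairs ] (weight p ℕ.* ∑[ q ∈ pairs ] (c q ℕ.* ι q p))
        incidences-≥ = begin
          ∑ pairs c ℕ.* α ^ m
            ≡⟨ ∑-*ʳ pairs (α ^ m) c ⟨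
          ∑[ q ∈ pairs ] (c q ℕ.* α ^ m)
            ≤⟨ ∑-mono pairs rich ⟩
          ∑[ q ∈ pairs ] (c q ℕ.* ∑[ p ∈ pairs ] (weight p ℕ.* ι q p))
            ≡⟨ ∑-cong pairs (λ q → ∑-*ˡ pairs (c q) _) ⟨
          ∑[ q ∈ pairs ] ∑[ p ∈ pairs ] (c q ℕ.* (weight p ℕ.* ι q p))
            ≡⟨ ∑-comm pairs pairs _ ⟩
          ∑[ p ∈ pairs ] ∑[ q ∈ pairs ] (c q ℕ.* (weight p ℕ.* ι q p))
            ≡⟨ ∑-cong pairs (λ p → trans
                 (∑-cong pairs λ q → S.solve 3 (λ c w i → c S.:* (w S.:* i) S.:= w S.:* (c S.:* i)) refl (c q) (weight p) (ι q p))
                 (∑-*ˡ pairs (weight p) _)) ⟩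
          ∑[ p ∈ pairs ] (weight p ℕ.* ∑[ q ∈ pairs ] (c q ℕ.* ι q p)) ∎
          where
          open ℕ.≤-Reasoning
          module S = +-*-Solver

        weight-idem : ∀ p → weight p ℕ.* weight p ≤ weight p
        weight-idem (b , t) with allᵇ B b | T t
        ... | true  | true  = ℕ.≤-refl
        ... | true  | false = z≤n
        ... | false | _     = z≤n

      sumsOfSquares-incidences : ∃ λ S →
        N ℕ.* (α ^ m ℕ.* υ ℕ.* α ^ m) ≤ S ℕ.+ β ^ m ℕ.* τ ℕ.* (α ^ m ℕ.* υ) ×
        S ℕ.* S ≤ β ^ m ℕ.* τ ℕ.* (N ℕ.* (α ^ m ℕ.* υ ℕ.* (w ^ m ℕ.* (N ℕ.* (N ^ m ℕ.* 2)))))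
      sumsOfSquares-incidences =
        let S , le , sq = incidenceBound pairs pairs c weight ι N (N ^ m) E degree size correlation weight-idem
        in S ,
           subst₂ (λ h P → N ℕ.* (h ℕ.* α ^ m) ≤ S ℕ.+ P ℕ.* h) ∑-c ∑-weight (ℕ.≤-trans (ℕ.*-monoʳ-≤ N incidences-≥) le) ,
           subst₂ (λ h P → S ℕ.* S ≤ P ℕ.* (N ℕ.* (h ℕ.* E))) ∑-c ∑-weight sq

      units-majority : α ≤ υ ℕ.+ w
      units-majority = begin
        α                                                    ≤⟨ ∑-mono all split ⟩
        ∑[ x ∈ all ] (⟦ A x ∧ unitᵇ x ⟧ ℕ.+ ν x)             ≡⟨ ∑-+ all _ _ ⟩
        υ ℕ.+ ∑ all ν                                        ≤⟨ ℕ.+-monoʳ-≤ υ ∑-ν ⟩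
        υ ℕ.+ w                                              ∎
        where
        open ℕ.≤-Reasoning
        split : ∀ x → ⟦ A x ⟧ ≤ ⟦ A x ∧ unitᵇ x ⟧ ℕ.+ ν x
        split x with A x | unitᵇ x
        ... | true  | true  = ℕ.≤-refl
        ... | true  | false = ℕ.≤-refl
        ... | false | _     = z≤n

-- Subsets of a finite ring, its copy on indices, and the invertibility of 2 in odd order.

∈-tabulate⁺ : ∀ {n} (p : Fin n → Bool) {i} → p i ≡ true → i Sub.∈ tabulate p
∈-tabulate⁺ p {i} pi = lookup⇒[]= i _ (trans (lookup∘tabulate p i) pi)

∈-tabulate⁻ : ∀ {n} (p : Fin n → Bool) {i} → i Sub.∈ tabulate p → p i ≡ true
∈-tabulate⁻ p {i} i∈ = trans (sym (lookup∘tabulate p i)) ([]=⇒lookup i∈)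

module FiniteRing {a ℓ} (R : FiniteCommutativeRing a ℓ) where
  open FiniteCommutativeRing R hiding (sym; trans; refl; zero; _≡_mod⟨_⟩; _^_)
  private module R = FiniteCommutativeRing R

  element-index : ∀ x → element (index x) ≈ x
  element-index x = Inverse.inverseʳ enumeration refl

  index-element : ∀ i → index (element i) ≡ i
  index-element i = Inverse.inverseˡ enumeration R.refl

  index-cong : ∀ {x y} → x ≈ y → index x ≡ index y
  index-cong = Inverse.to-cong enumeration

  element-injective : ∀ {i j} → element i ≈ element j → i ≡ j
  element-injective {i} {j} e = trans (sym (index-element i)) (trans (index-cong e) (index-element j))

  index-injective : ∀ {x y} → index x ≡ index y → x ≈ y
  index-injective {x} {y} e = R.trans (R.sym (element-index x)) (R.trans (R.reflexive (cong element e)) (element-index y))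

  rawIndexRing : RawRing 0ℓ 0ℓ
  rawIndexRing = record
    { Carrier = Fin order
    ; _≈_     = _≡_
    ; _+_     = λ i j → index (element i + element j)
    ; _*_     = λ i j → index (element i * element j)
    ; -_      = λ i → index (- element i)
    ; 0#      = index 0#
    ; 1#      = index 1#
    }

  -- The laws are pulled back along `element`, an injective homomorphism from the indices. The
  -- incidence argument then runs over `Fin order` with decidable propositional equality.
  isIndexRing : IsCommutativeRing _≡_ (λ i j → index (element i + element j)) (λ i j → index (element i * element j))
                                  (λ i → index (- element i)) (index 0#) (index 1#)
  isIndexRing = RingMonomorphism.isCommutativeRing isRingMonomorphism isCommutativeRing
    where
    open RingMorphisms rawIndexRing R.rawRing
    isRingMonomorphism : IsRingMonomorphism element
    isRingMonomorphism = record
      { isRingHomomorphism = record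
        { isSemiringHomomorphism = record
          { isNearSemiringHomomorphism = record
            { +-isMonoidHomomorphism = record
              { isMagmaHomomorphism = record
                { isRelHomomorphism = record { cong = λ e → R.reflexive (cong element e) }
                ; homo              = λ _ _ → element-index _
                }
              ; ε-homo = element-index 0#
              }
            ; *-homo = λ _ _ → element-index _
            }
          ; 1#-homo = element-index 1#
          }
        ; -‿homo = λ _ → element-index _
        }
      ; injective = element-injective
      }

  ⊕-∈ : ∀ {A B x y} → x ∈ A → y ∈ B → x + y ∈ A ⊕ B
  ⊕-∈ {A} {B} {x} {y} x∈A y∈B = ∈-tabulate⁺ _ (dec-true (any? λ i → any? λ j → (i ∈? A) ×-dec (j ∈? B) ×-dec (index (x + y) ≟ index (element i + element j)))
    (index x , index y , x∈A , y∈B , index-cong (R.sym (R.+-cong (element-index x) (element-index y)))))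

  squares-∈ : ∀ {A x} → x ∈ A → x * x ∈ squares A
  squares-∈ {A} {x} x∈A = ∈-tabulate⁺ _ (dec-true (any? λ i → (i ∈? A) ×-dec (index (x * x) ≟ index (element i * element i)))
    (index x , x∈A , index-cong (R.sym (R.*-cong (element-index x) (element-index x)))))

  -- Translation by 1 permutes the ring, so the sum of all elements equals
  -- itself plus order × 1.
  module _ where
    open import Algebra.Properties.CommutativeMonoid.Sum R.+-commutativeMonoid
    open import Algebra.Properties.Semiring.Mult R.semiring renaming (_×_ to _×ᴿ_)
    open import Algebra.Properties.Ring R.ring using (+-identityʳ-unique; +-inverseʳ-unique; -‿distribʳ-*)

    order×1≈0 : order ×ᴿ 1# ≈ 0#
    order×1≈0 = +-identityʳ-unique (sum element) _ (begin
      sum element + order ×ᴿ 1#                          ≈⟨ R.+-congˡ (sum-replicate order) ⟨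
      sum element + sum {order} (λ _ → 1#)               ≈⟨ ∑-distrib-+ element (λ _ → 1#) ⟨
      sum (λ i → element i + 1#)                         ≈⟨ sum-cong-≋ (λ i → element-index (element i + 1#)) ⟨
      sum (λ i → element (index (element i + 1#)))       ≈⟨ sum-permute element shift ⟨
      sum element                                        ∎)
      where
      open import Relation.Binary.Reasoning.Setoid R.setoid
      cancel : ∀ {u v} → u + v ≈ 0# → ∀ i → index (element (index (element i + u)) + v) ≡ i
      cancel {u} {v} u+v≈0 i = trans (index-cong (begin
        element (index (element i + u)) + v      ≈⟨ R.+-congʳ (element-index _) ⟩
        element i + u + v                        ≈⟨ R.+-assoc _ _ _ ⟩
        element i + (u + v)                      ≈⟨ R.+-congˡ u+v≈0 ⟩
        element i + 0#                           ≈⟨ R.+-identityʳ _ ⟩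
        element i                                ∎)) (index-element i)
      shift : Permutation order order
      shift = permutation (λ i → index (element i + 1#)) (λ i → index (element i + - 1#))
        (cancel (R.-‿inverseˡ 1#)) (cancel (R.-‿inverseʳ 1#))

    -- With order = 2h + 1 and order · 1 = 0 one has 2 (h · 1) = - 1, so - (h · 1) is the inverse of
    -- 2.
    odd⇒unit-2 : ∀ {h} → order ≡ suc (h ℕ.+ h) → ∃ λ y → (1# + 1#) * y ≈ 1#
    odd⇒unit-2 {h} odd = - H , (begin
      (1# + 1#) * - H      ≈⟨ -‿distribʳ-* (1# + 1#) H ⟨
      - ((1# + 1#) * H)    ≈⟨ R.-‿cong (R.trans (R.distribʳ H 1# 1#) (R.+-cong (R.*-identityˡ H) (R.*-identityˡ H))) ⟩
      - (H + H)            ≈⟨ +-inverseʳ-unique (H + H) 1# (begin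
          H + H + 1#               ≈⟨ R.+-comm _ _ ⟩
          1# + (H + H)             ≈⟨ R.+-congˡ (×-homo-+ 1# h h) ⟨
          suc (h ℕ.+ h) ×ᴿ 1#      ≡⟨ cong (_×ᴿ 1#) odd ⟨
          order ×ᴿ 1#              ≈⟨ order×1≈0 ⟩
          0#                       ∎) ⟨
      1#                   ∎)
      where
      open import Relation.Binary.Reasoning.Setoid R.setoid
      H = h ×ᴿ 1#

-- Arithmetic of the uniformizer: units, annihilators, and the sizes of the ring and of (z).

module Valuation {a ℓ} (R : FiniteCommutativeRing a ℓ)
                 (z : FiniteCommutativeRing.Carrier R) (uniformizer : FiniteCommutativeRing.IsUniformizer R z)
                 (r : ℕ) (nilpotency : FiniteCommutativeRing.IsNilpotencyIndex R z r) where
  open FiniteCommutativeRing R hiding (sym; trans; refl; zero)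
  private module R = FiniteCommutativeRing R
  open FiniteRing R
  open IntegerRingSolver commutativeRing
  open import Algebra.Properties.Ring R.ring using (x∙y⁻¹≈ε⇒x≈y; [y-z]x≈yx-zx; -0#≈0#)
  open import Relation.Binary.Reasoning.Setoid R.setoid
  open IsNilpotencyIndex nilpotency

  private
    𝔪 : SubsetR
    𝔪 = proj₁ uniformizer

    open IsMaximalIdeal (proj₁ (proj₂ uniformizer))
    open IsIdeal isIdeal

    ∈𝔪⇒z∣ : ∀ {x} → x ∈ 𝔪 → z ∣ x
    ∈𝔪⇒z∣ = Equivalence.to (proj₂ (proj₂ uniformizer) _)

    z∣⇒∈𝔪 : ∀ {x} → z ∣ x → x ∈ 𝔪
    z∣⇒∈𝔪 = Equivalence.from (proj₂ (proj₂ uniformizer) _)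

  ∣-respʳ : ∀ {d x y} → x ≈ y → d ∣ x → d ∣ y
  ∣-respʳ x≈y (t , e) = t , R.trans e x≈y

  z∤1 : ¬ (z ∣ 1#)
  z∤1 z∣1 = proper (⊆-antisym (λ _ → ∈⊤) λ {i} _ →
    subst (Sub._∈ 𝔪) (trans (index-cong (R.*-identityʳ _)) (index-element i)) (*-absorb (element i) (z∣⇒∈𝔪 z∣1)))

  -- Here g is the partial geometric sum 1 + z y + ... + (z y)^(k-1) and e is y^k. Keeping z^k apart
  -- from e lets z^r = 0 remove the remainder.
  geometric : ∀ y k → ∃ λ g → ∃ λ e → (1# - z * y) * g ≈ 1# - z ^ k * e
  geometric y zero    = 0# , 1# , R.trans (R.zeroʳ _)
    (R.sym (R.trans (R.+-congˡ (R.-‿cong (R.*-identityʳ 1#))) (R.-‿inverseʳ 1#)))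
  geometric y (suc k) with g , e , eq ← geometric y k = g + z ^ k * e , y * e , (begin
    (1# - z * y) * (g + z ^ k * e)
      ≈⟨ R.distribˡ _ _ _ ⟩
    (1# - z * y) * g + (1# - z * y) * (z ^ k * e)
      ≈⟨ R.+-cong eq (R.trans ([y-z]x≈yx-zx _ _ _) (R.+-congʳ (R.*-identityˡ _))) ⟩
    (1# - z ^ k * e) + (z ^ k * e - z * y * (z ^ k * e))
      ≈⟨ solve 5 (λ o p e z y → (o :- p :* e) :+ (p :* e :- z :* y :* (p :* e)) := o :- z :* p :* (y :* e)) R.refl 1# (z ^ k) e z y ⟩
    1# - z * z ^ k * (y * e) ∎)

  1-zy-unit : ∀ y → ∃ λ g → (1# - z * y) * g ≈ 1#
  1-zy-unit y with g , e , eq ← geometric y r = g , (begin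
    (1# - z * y) * g     ≈⟨ eq ⟩
    1# - z ^ r * e       ≈⟨ R.+-congˡ (R.-‿cong (R.*-congʳ vanishes)) ⟩
    1# - 0# * e          ≈⟨ R.+-congˡ (R.trans (R.-‿cong (R.zeroˡ e)) -0#≈0#) ⟩
    1# + 0#              ≈⟨ R.+-identityʳ 1# ⟩
    1#                   ∎)


  -- For x ∉ 𝔪 maximality makes 𝔪 + (x) the whole ring, so that x k = 1 − z s for
  -- some k and s; and 1 − z s is a unit because z is nilpotent.
  module _ (x : Carrier) where

    private
      spanned? : ∀ i → Dec (∃ λ j → index (element i - x * element j) Sub.∈ 𝔪)
      spanned? i = any? λ j → index (element i - x * element j) ∈? 𝔪

    𝔪+⟨_⟩ : SubsetR
    𝔪+⟨_⟩ = tabulate λ i → does (spanned? i)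

    private
      J = 𝔪+⟨_⟩

    ∈-𝔪+⟨⟩⁻ : ∀ {y} → y ∈ J → ∃ λ k → z ∣ (y - x * k)
    ∈-𝔪+⟨⟩⁻ {y} y∈J with j , ∈𝔪 ← does-true (spanned? (index y)) (∈-tabulate⁻ _ y∈J) =
      element j , ∣-respʳ (R.+-congʳ (element-index y)) (∈𝔪⇒z∣ ∈𝔪)

    ∈-𝔪+⟨⟩⁺ : ∀ {y} k → z ∣ (y - x * k) → y ∈ J
    ∈-𝔪+⟨⟩⁺ {y} k z∣ = ∈-tabulate⁺ _ (dec-true (spanned? (index y))
      (index k , z∣⇒∈𝔪 (∣-respʳ (R.sym (R.+-cong (element-index y) (R.-‿cong (R.*-congˡ (element-index k))))) z∣)))

    𝔪+⟨⟩-isIdeal : IsIdeal J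
    𝔪+⟨⟩-isIdeal = record
      { 0∈       = ∈-𝔪+⟨⟩⁺ 0# (0# , R.trans (R.zeroˡ z) (R.sym (R.trans (R.+-congˡ (R.-‿cong (R.zeroʳ x))) (R.-‿inverseʳ 0#))))
      ; +-closed = λ {u} {v} u∈J v∈J →
          let k , s , es = ∈-𝔪+⟨⟩⁻ u∈J
              l , t , et = ∈-𝔪+⟨⟩⁻ v∈J
          in ∈-𝔪+⟨⟩⁺ (k + l) (s + t , (begin
            (s + t) * z                    ≈⟨ R.distribʳ z s t ⟩
            s * z + t * z                  ≈⟨ R.+-cong es et ⟩
            (u - x * k) + (v - x * l)      ≈⟨ solve 5 (λ u v x k l → (u :- x :* k) :+ (v :- x :* l) := (u :+ v) :- x :* (k :+ l)) R.refl u v x k l ⟩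
            (u + v) - x * (k + l)          ∎))
      ; *-absorb = λ c {u} u∈J →
          let k , s , es = ∈-𝔪+⟨⟩⁻ u∈J
          in ∈-𝔪+⟨⟩⁺ (c * k) (c * s , (begin
            c * s * z                      ≈⟨ R.*-assoc c s z ⟩
            c * (s * z)                    ≈⟨ R.*-congˡ es ⟩
            c * (u - x * k)                ≈⟨ solve 4 (λ c u x k → c :* (u :- x :* k) := c :* u :- x :* (c :* k)) R.refl c u x k ⟩
            c * u - x * (c * k)            ∎))
      }

    𝔪⊆𝔪+⟨⟩ : 𝔪 Sub.⊆ J
    𝔪⊆𝔪+⟨⟩ {i} i∈𝔪 = subst (Sub._∈ J) (index-element i) (∈-𝔪+⟨⟩⁺ 0#
      (∣-respʳ (R.sym (R.trans (R.+-congˡ (R.trans (R.-‿cong (R.zeroʳ x)) -0#≈0#)) (R.+-identityʳ _)))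
        (∈𝔪⇒z∣ (subst (Sub._∈ 𝔪) (sym (index-element i)) i∈𝔪))))

    unit⊎z∣ : (∃ λ y → x * y ≈ 1#) ⊎ z ∣ x
    unit⊎z∣ with maximal J 𝔪+⟨⟩-isIdeal 𝔪⊆𝔪+⟨⟩
    ... | inj₁ J≡𝔪 = inj₂ (∈𝔪⇒z∣ (subst (x ∈_) J≡𝔪 (∈-𝔪+⟨⟩⁺ 1# (0# , (begin
      0# * z        ≈⟨ R.zeroˡ z ⟩
      0#            ≈⟨ R.-‿inverseʳ x ⟨
      x - x         ≈⟨ R.+-congˡ (R.-‿cong (R.*-identityʳ x)) ⟨
      x - x * 1#    ∎)))))
    ... | inj₂ J≡⊤ with k , s , es ← ∈-𝔪+⟨⟩⁻ {1#} (subst (1# ∈_) (sym J≡⊤) ∈⊤) with g , eg ← 1-zy-unit s = inj₁ (k * g , (begin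
      x * (k * g)                   ≈⟨ solve 4 (λ o x k g → x :* (k :* g) := (o :- (o :- x :* k)) :* g) R.refl 1# x k g ⟩
      (1# - (1# - x * k)) * g       ≈⟨ R.*-congʳ (R.+-congˡ (R.-‿cong (R.trans (R.sym es) (R.*-comm s z)))) ⟩
      (1# - z * s) * g              ≈⟨ eg ⟩
      1#                            ∎))

  unit-+⇒unit : ∀ {x y} → (∃ λ u → (x + y) * u ≈ 1#) → (∃ λ u → x * u ≈ 1#) ⊎ (∃ λ u → y * u ≈ 1#)
  unit-+⇒unit {x} {y} (u , eu) with unit⊎z∣ x | unit⊎z∣ y
  ... | inj₁ unit     | _             = inj₁ unit
  ... | inj₂ _        | inj₁ unit     = inj₂ unit
  ... | inj₂ (s , es) | inj₂ (t , et) = contradiction ((s + t) * u , (begin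
    (s + t) * u * z          ≈⟨ solve 4 (λ s t u z → (s :+ t) :* u :* z := (s :* z :+ t :* z) :* u) R.refl s t u z ⟩
    (s * z + t * z) * u      ≈⟨ R.*-congʳ (R.+-cong es et) ⟩
    (x + y) * u              ≈⟨ eu ⟩
    1#                       ∎)) z∤1

  -- Induction on k. If v = v′ z^k with v′ a unit, then z v = 0 forces z^(k+1) = 0, against the
  -- minimality of r when k + 1 < r; so z divides v′ and the exponent grows by one.
  z-annihilator : ∀ {v} → z * v ≈ 0# → ∀ {k} → k ℕ.< r → (z ^ k) ∣ v
  z-annihilator {v} zv≈0 {zero}  _   = v , R.*-identityʳ v
  z-annihilator {v} zv≈0 {suc k} k<r with v′ , e ← z-annihilator zv≈0 (ℕ.<-trans (ℕ.n<1+n k) k<r) with unit⊎z∣ v′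
  ... | inj₂ (s , es) = s , (begin
    s * (z * z ^ k)      ≈⟨ R.*-assoc s z (z ^ k) ⟨
    s * z * z ^ k        ≈⟨ R.*-congʳ es ⟩
    v′ * z ^ k           ≈⟨ e ⟩
    v                    ∎)
  ... | inj₁ (u , eu) = contradiction (least (suc k) (s≤s z≤n) (begin
    z * z ^ k                  ≈⟨ R.*-identityʳ _ ⟨
    z * z ^ k * 1#             ≈⟨ R.*-congˡ eu ⟨
    z * z ^ k * (v′ * u)       ≈⟨ solve 4 (λ z p v u → z :* p :* (v :* u) := z :* (v :* p) :* u) R.refl z (z ^ k) v′ u ⟩
    z * (v′ * z ^ k) * u       ≈⟨ R.*-congʳ (R.*-congˡ e) ⟩
    z * v * u                  ≈⟨ R.*-congʳ zv≈0 ⟩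
    0# * u                     ≈⟨ R.zeroˡ u ⟩
    0#                         ∎)) (ℕ.<⇒≱ k<r)

  -- From z (d - d′) = s z^(k+1) one cannot cancel z, but d - d′ - s z^k is annihilated by z and is
  -- therefore itself a multiple of z^k.
  ∣-cancel : ∀ {k} → k ℕ.< r → ∀ {ρ d d′} → (z ^ suc k) ∣ ((ρ + z * d) - (ρ + z * d′)) → (z ^ k) ∣ (d - d′)
  ∣-cancel {k} k<r {ρ} {d} {d′} (s , es) = let t , et = z-annihilator annihilated k<r in t + s , (begin
    (t + s) * z ^ k                            ≈⟨ R.distribʳ (z ^ k) t s ⟩
    t * z ^ k + s * z ^ k                      ≈⟨ R.+-congʳ et ⟩
    ((d - d′) - s * z ^ k) + s * z ^ k         ≈⟨ solve 3 (λ d d′ x → ((d :- d′) :- x) :+ x := d :- d′) R.refl d d′ (s * z ^ k) ⟩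
    d - d′                                     ∎)
    where
    annihilated : z * ((d - d′) - s * z ^ k) ≈ 0#
    annihilated = begin
      z * ((d - d′) - s * z ^ k)
        ≈⟨ solve 4 (λ z D s p → z :* (D :- s :* p) := z :* D :- s :* (z :* p)) R.refl z (d - d′) s (z ^ k) ⟩
      z * (d - d′) - s * (z * z ^ k)
        ≈⟨ R.+-congʳ (solve 4 (λ z d d′ ρ → z :* (d :- d′) := (ρ :+ z :* d) :- (ρ :+ z :* d′)) R.refl z d d′ ρ) ⟩
      ((ρ + z * d) - (ρ + z * d′)) - s * (z * z ^ k)
        ≈⟨ R.+-congˡ (R.-‿cong es) ⟩
      ((ρ + z * d) - (ρ + z * d′)) - ((ρ + z * d) - (ρ + z * d′))
        ≈⟨ R.-‿inverseʳ _ ⟩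
      0# ∎

  -- Expansion in powers of z with a fixed set of representatives modulo z.
  module Digits (q : ℕ) (quotient-order : QuotientHasOrder z q) where

    private
      residue : Carrier → Fin q
      residue = proj₁ quotient-order

      residue-cong : ∀ {x y} → z ∣ (x - y) → residue x ≡ residue y
      residue-cong = proj₁ (proj₂ quotient-order)

      residue-injective : ∀ {x y} → residue x ≡ residue y → z ∣ (x - y)
      residue-injective = proj₁ (proj₂ (proj₂ quotient-order))

      representative : Fin q → Carrier
      representative c = proj₁ (proj₂ (proj₂ (proj₂ quotient-order)) c)

      residue-representative : ∀ c → residue (representative c) ≡ c
      residue-representative c = proj₂ (proj₂ (proj₂ (proj₂ quotient-order)) c)
        (0# , R.trans (R.zeroˡ z) (R.sym (R.-‿inverseʳ _)))

      division : ∀ x → z ∣ (x - representative (residue x))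
      division x = residue-injective (sym (residue-representative (residue x)))

      tail : Carrier → Carrier
      tail x = _∣ʳ_.quotient (division x)

    encode : ∀ k → Carrier → Fin (q ℕ.^ k)
    encode zero    x = zero
    encode (suc k) x = combine (residue x) (encode k (tail x))

    horner : ∀ k → Fin q × Fin (q ℕ.^ k) → Carrier
    decode : ∀ k → Fin (q ℕ.^ k) → Carrier
    horner k (c , i) = representative c + z * decode k i
    decode zero    _ = 0#
    decode (suc k) i = horner k (remQuot (q ℕ.^ k) i)

    decode-encode : ∀ k x → (z ^ k) ∣ (x - decode k (encode k x))
    decode-encode zero    x = (x - 0#) , R.*-identityʳ _
    decode-encode (suc k) x with s , es ← decode-encode k (tail x) = s , (begin
      s * (z * z ^ k)
        ≈⟨ solve 3 (λ s z p → s :* (z :* p) := z :* (s :* p)) R.refl s z (z ^ k) ⟩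
      z * (s * z ^ k)
        ≈⟨ R.*-congˡ es ⟩
      z * (tail x - d)
        ≈⟨ solve 3 (λ z t d → z :* (t :- d) := t :* z :- z :* d) R.refl z (tail x) d ⟩
      tail x * z - z * d
        ≈⟨ R.+-congʳ (_∣ʳ_.equality (division x)) ⟩
      (x - ρ) - z * d
        ≈⟨ solve 4 (λ x ρ z d → (x :- ρ) :- z :* d := x :- (ρ :+ z :* d)) R.refl x ρ z d ⟩
      x - horner k (residue x , encode k (tail x))
        ≡⟨ cong (λ p → x - horner k p) (remQuot-combine (residue x) (encode k (tail x))) ⟨
      x - decode (suc k) (encode (suc k) x) ∎)
      where
      d = decode k (encode k (tail x))
      ρ = representative (residue x)

    residue-horner : ∀ k c i → residue (horner k (c , i)) ≡ c
    residue-horner k c i = trans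
      (residue-cong (decode k i , solve 3 (λ d z ρ → d :* z := (ρ :+ z :* d) :- ρ) R.refl (decode k i) z (representative c)))
      (residue-representative c)

    -- The lowest digit is read off modulo z. Once the lowest digits agree, `∣-cancel` strips one
    -- factor z and the remaining digits are compared by `decode-inj`.
    horner-injective : ∀ k → k ℕ.< r → (∀ {i j} → (z ^ k) ∣ (decode k i - decode k j) → i ≡ j) →
      ∀ {p p′} → (z ^ suc k) ∣ (horner k p - horner k p′) → p ≡ p′
    horner-injective k k<r decode-inj {c , i} {c′ , i′} z∣@(s , es) = cong₂ _,_ c≡c′
      (decode-inj (∣-cancel k<r (subst (λ c′ → (z ^ suc k) ∣ (horner k (c , i) - horner k (c′ , i′))) (sym c≡c′) z∣)))
      where
      c≡c′ : c ≡ c′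
      c≡c′ = trans (sym (residue-horner k c i)) (trans (residue-cong (s * z ^ k , R.trans
        (solve 3 (λ s p z → s :* p :* z := s :* (z :* p)) R.refl s (z ^ k) z) es)) (residue-horner k c′ i′))

    decode-injective : ∀ k → k ≤ r → ∀ {i j} → (z ^ k) ∣ (decode k i - decode k j) → i ≡ j
    decode-injective zero    _   {zero} {zero} _ = refl
    decode-injective (suc k) k<r {i} {j} z∣ = trans (sym (combine-remQuot {q} (q ℕ.^ k) i))
      (trans (cong (uncurry combine) (horner-injective k k<r (decode-injective k (ℕ.<⇒≤ k<r)) z∣)) (combine-remQuot {q} (q ℕ.^ k) j))

    z^r∣⇒≈ : ∀ {x y} → (z ^ r) ∣ (x - y) → x ≈ y
    z^r∣⇒≈ {x} {y} (s , es) = x∙y⁻¹≈ε⇒x≈y x y (R.trans (R.sym es) (R.trans (R.*-congˡ vanishes) (R.zeroʳ s)))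

    -- Injections in both directions: z^r = 0 makes `decode r` a left inverse of `encode r`, and the
    -- minimality of r, through `z-annihilator`, makes `decode r` injective.
    order≡q^r : order ≡ q ℕ.^ r
    order≡q^r = ℕ.≤-antisym
      (injective⇒≤ {f = λ i → encode r (element i)} λ {i} {j} e → element-injective (R.trans (≈decode i)
        (R.trans (R.reflexive (cong (decode r) e)) (R.sym (≈decode j)))))
      (injective⇒≤ {f = λ i → index (decode r i)} λ {i} {j} e → decode-injective r ℕ.≤-refl
        (0# , R.trans (R.zeroˡ _) (R.sym (R.trans (R.+-congʳ (index-injective e)) (R.-‿inverseʳ _)))))
      where
      ≈decode : ∀ i → element i ≈ decode r (encode r (element i))
      ≈decode i = z^r∣⇒≈ (decode-encode r (element i))

    nonunit : Fin (q ℕ.^ (r ℕ.∸ 1)) → Carrier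
    nonunit j = z * decode (r ℕ.∸ 1) j

    -- Because z · z^(r-1) = 0, the product t z depends only on t modulo z^(r-1), that is, on r - 1
    -- digits of t. This gives at most q^(r-1) nonunits.
    nonunit-surjective : ∀ {x} → z ∣ x → ∃ λ j → nonunit j ≈ x
    nonunit-surjective {x} (t , et) with s , es ← decode-encode (r ℕ.∸ 1) t = j , R.sym (z^r∣⇒≈ (s , (begin
      s * z ^ r                            ≡⟨ cong (λ k → s * z ^ k) (ℕ.m+[n∸m]≡n positive) ⟨
      s * (z * z ^ (r ℕ.∸ 1))              ≈⟨ solve 3 (λ s z p → s :* (z :* p) := z :* (s :* p)) R.refl s z _ ⟩
      z * (s * z ^ (r ℕ.∸ 1))              ≈⟨ R.*-congˡ es ⟩
      z * (t - decode (r ℕ.∸ 1) j)         ≈⟨ solve 3 (λ z t d → z :* (t :- d) := t :* z :- z :* d) R.refl z t _ ⟩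
      t * z - nonunit j                    ≈⟨ R.+-congʳ et ⟩
      x - nonunit j                        ∎)))
      where j = encode (r ℕ.∸ 1) t

open import Data.Nat using (ℕ; _+_; _*_; _∸_; _^_; _⊔_; _<_; _≤_)

-- From incidences to the final inequality between natural numbers.

module _ (N w m a u P S : ℕ) .{{_ : NonZero N}} .{{_ : NonZero a}}
         (2w≤a : 2 ℕ.* w ≤ a) (a≤u+w : a ≤ u ℕ.+ w)
         (incidences : N ℕ.* (a ^ m ℕ.* u ℕ.* a ^ m) ≤ S ℕ.+ P ℕ.* (a ^ m ℕ.* u))
         (squared : S ℕ.* S ≤ P ℕ.* (N ℕ.* (a ^ m ℕ.* u ℕ.* (w ^ m ℕ.* (N ℕ.* (N ^ m ℕ.* 2)))))) where

  private
    h = a ^ m ℕ.* u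

    a≤2u : a ≤ 2 ℕ.* u
    a≤2u = ℕ.+-cancelˡ-≤ a _ _ (begin
      a ℕ.+ a                  ≤⟨ ℕ.+-mono-≤ a≤u+w a≤u+w ⟩
      u ℕ.+ w ℕ.+ (u ℕ.+ w)    ≡⟨ solve 2 (λ u w → u :+ w :+ (u :+ w) := con 2 :* w :+ con 2 :* u) refl u w ⟩
      2 ℕ.* w ℕ.+ 2 ℕ.* u      ≤⟨ ℕ.+-monoˡ-≤ _ 2w≤a ⟩
      a ℕ.+ 2 ℕ.* u            ∎)
      where
      open ℕ.≤-Reasoning
      open +-*-Solver

    instance
      u≢0 : NonZero u
      u≢0 = ℕ.m*n≢0⇒n≢0 2 {{ℕ.>-nonZero (ℕ.<-≤-trans (ℕ.>-nonZero⁻¹ a) a≤2u)}}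

      h≢0 : NonZero h
      h≢0 = ℕ.m*n≢0 (a ^ m) u {{ℕ.m^n≢0 a m}}

  -- The cases are which part of the incidence bound supplies at least half: the mean P h or the
  -- deviation S. In the second, 16 = 4 · 2 · 2 arises from squaring 2 S, from the two square roots
  -- in the surplus, and from a ≤ 2 u.
  main-or-error : N ℕ.* a ^ m ≤ 2 ℕ.* P ⊎ a ^ m ℕ.* a ^ m ℕ.* a ^ m ℕ.* a ≤ 16 ℕ.* (P ℕ.* (w ^ m ℕ.* N ^ m))
  main-or-error with ℕ.≤-total (N ℕ.* (h ℕ.* a ^ m)) (2 ℕ.* S)
  ... | inj₂ small = inj₁ (ℕ.*-cancelʳ-≤ _ _ h (ℕ.+-cancelˡ-≤ (N ℕ.* (h ℕ.* a ^ m)) _ _ (begin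
    L ℕ.+ N ℕ.* a ^ m ℕ.* h             ≡⟨ solve 3 (λ n h x → n :* (h :* x) :+ n :* x :* h := con 2 :* (n :* (h :* x))) refl N h (a ^ m) ⟩
    2 ℕ.* L                             ≤⟨ ℕ.*-monoʳ-≤ 2 incidences ⟩
    2 ℕ.* (S ℕ.+ P ℕ.* h)               ≡⟨ solve 3 (λ s p h → con 2 :* (s :+ p :* h) := con 2 :* s :+ con 2 :* p :* h) refl S P h ⟩
    2 ℕ.* S ℕ.+ 2 ℕ.* P ℕ.* h           ≤⟨ ℕ.+-monoˡ-≤ _ small ⟩
    L ℕ.+ 2 ℕ.* P ℕ.* h                 ∎)))
    where
    open ℕ.≤-Reasoning
    open +-*-Solver
    L = N ℕ.* (h ℕ.* a ^ m)
  ... | inj₁ large = inj₂ (begin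
    x ℕ.* x ℕ.* x ℕ.* a                          ≤⟨ ℕ.*-monoʳ-≤ (x ℕ.* x ℕ.* x) a≤2u ⟩
    x ℕ.* x ℕ.* x ℕ.* (2 ℕ.* u)                  ≡⟨ solve 2 (λ x u → x :* x :* x :* (con 2 :* u) := con 2 :* (x :* u :* x :* x)) refl x u ⟩
    2 ℕ.* (h ℕ.* x ℕ.* x)                        ≤⟨ ℕ.*-monoʳ-≤ 2 cancelled ⟩
    2 ℕ.* (8 ℕ.* (P ℕ.* (w ^ m ℕ.* N ^ m)))      ≡⟨ ℕ.*-assoc 2 8 (P ℕ.* (w ^ m ℕ.* N ^ m)) ⟨
    16 ℕ.* (P ℕ.* (w ^ m ℕ.* N ^ m))             ∎)
    where
    open ℕ.≤-Reasoning
    open +-*-Solver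
    x = a ^ m
    W = w ^ m
    Z = N ^ m
    cancelled : h ℕ.* x ℕ.* x ≤ 8 ℕ.* (P ℕ.* (W ℕ.* Z))
    cancelled = ℕ.*-cancelˡ-≤ (N ℕ.* N ℕ.* h) {{ℕ.m*n≢0 (N ℕ.* N) h {{ℕ.m*n≢0 N N}}}} (begin
      N ℕ.* N ℕ.* h ℕ.* (h ℕ.* x ℕ.* x)
        ≡⟨ solve 3 (λ n h x → n :* n :* h :* (h :* x :* x) := n :* (h :* x) :* (n :* (h :* x))) refl N h x ⟩
      N ℕ.* (h ℕ.* x) ℕ.* (N ℕ.* (h ℕ.* x))
        ≤⟨ ℕ.*-mono-≤ large large ⟩
      2 ℕ.* S ℕ.* (2 ℕ.* S)
        ≡⟨ solve 1 (λ s → con 2 :* s :* (con 2 :* s) := con 4 :* (s :* s)) refl S ⟩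
      4 ℕ.* (S ℕ.* S)
        ≤⟨ ℕ.*-monoʳ-≤ 4 squared ⟩
      4 ℕ.* (P ℕ.* (N ℕ.* (h ℕ.* (W ℕ.* (N ℕ.* (Z ℕ.* 2))))))
        ≡⟨ solve 5 (λ p n h w z → con 4 :* (p :* (n :* (h :* (w :* (n :* (z :* con 2)))))) := n :* n :* h :* (con 8 :* (p :* (w :* z)))) refl P N h W Z ⟩
      N ℕ.* N ℕ.* h ℕ.* (8 ℕ.* (P ℕ.* (W ℕ.* Z))) ∎)

module _ (N w m a b t k : ℕ) .{{_ : NonZero N}} .{{_ : NonZero w}} .{{_ : NonZero a}} (a≤b : a ≤ b) where

  private
    M = b ⊔ t
    x = a ^ m
    y = b ^ m

    b^2m*t≤M^[2m+1] : y ℕ.* t ℕ.* y ≤ M ℕ.* (M ^ m ℕ.* M ^ m)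
    b^2m*t≤M^[2m+1] = begin
      y ℕ.* t ℕ.* y              ≡⟨ solve 2 (λ y t → y :* t :* y := t :* (y :* y)) refl y t ⟩
      t ℕ.* (y ℕ.* y)            ≤⟨ ℕ.*-mono-≤ (ℕ.m≤n⊔m b t) (ℕ.*-mono-≤ y≤ y≤) ⟩
      M ℕ.* (M ^ m ℕ.* M ^ m)    ∎
      where
      open ℕ.≤-Reasoning
      open +-*-Solver
      y≤ : y ≤ M ^ m
      y≤ = ℕ.^-monoˡ-≤ m (ℕ.m≤m⊔n b t)

  max-bound :
    N ℕ.* x ≤ 2 ℕ.* (y ℕ.* t) ⊎ x ℕ.* x ℕ.* x ℕ.* a ≤ 16 ℕ.* (y ℕ.* t ℕ.* (w ^ m ℕ.* N ^ m)) →
    N ℕ.* (w ^ m ℕ.* N ^ m) ≤ suc k ℕ.* (y ℕ.* (a ℕ.* x)) →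
    N ℕ.* (x ℕ.* x) ≤ 16 ℕ.* suc k ℕ.* (M ℕ.* (M ^ m ℕ.* M ^ m))
  max-bound (inj₁ main) _ = begin
    N ℕ.* (x ℕ.* x)                 ≡⟨ ℕ.*-assoc N x x ⟨
    N ℕ.* x ℕ.* x                   ≤⟨ ℕ.*-mono-≤ main (ℕ.^-monoˡ-≤ m a≤b) ⟩
    2 ℕ.* (y ℕ.* t) ℕ.* y           ≡⟨ ℕ.*-assoc 2 (y ℕ.* t) y ⟩
    -- The constant 2 is relaxed to 16 (k + 1), which the other case requires.
    2 ℕ.* (y ℕ.* t ℕ.* y)           ≤⟨ ℕ.*-mono-≤ (ℕ.≤-trans (s≤s (s≤s (z≤n {14}))) (ℕ.m≤m*n 16 (suc k))) b^2m*t≤M^[2m+1] ⟩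
    16 ℕ.* suc k ℕ.* (M ℕ.* (M ^ m ℕ.* M ^ m)) ∎
    where open ℕ.≤-Reasoning
  max-bound (inj₂ error) hyp = ℕ.≤-trans
    (ℕ.*-cancelˡ-≤ (x ℕ.* a ℕ.* V) {{ℕ.m*n≢0 (x ℕ.* a) V {{ℕ.m*n≢0 x a {{ℕ.m^n≢0 a m}}}} {{ℕ.m*n≢0 (w ^ m) (N ^ m) {{ℕ.m^n≢0 w m}} {{ℕ.m^n≢0 N m}}}}}} (begin
      x ℕ.* a ℕ.* V ℕ.* (N ℕ.* (x ℕ.* x))
        ≡⟨ solve 4 (λ x a v n → x :* a :* v :* (n :* (x :* x)) := n :* v :* (x :* x :* x :* a)) refl x a V N ⟩
      N ℕ.* V ℕ.* (x ℕ.* x ℕ.* x ℕ.* a)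
        ≤⟨ ℕ.*-mono-≤ hyp error ⟩
      suc k ℕ.* (y ℕ.* (a ℕ.* x)) ℕ.* (16 ℕ.* (y ℕ.* t ℕ.* V))
        ≡⟨ solve 6 (λ k y a x t v → k :* (y :* (a :* x)) :* (con 16 :* (y :* t :* v)) := x :* a :* v :* (con 16 :* k :* (y :* t :* y))) refl (suc k) y a x t V ⟩
      x ℕ.* a ℕ.* V ℕ.* (16 ℕ.* suc k ℕ.* (y ℕ.* t ℕ.* y)) ∎))
    (ℕ.*-monoʳ-≤ (16 ℕ.* suc k) b^2m*t≤M^[2m+1])
    where
    open ℕ.≤-Reasoning
    open +-*-Solver
    V = w ^ m ℕ.* N ^ m

-- Rational constants: replacing c and C by unit fractions.

fromℕ-ᵘ : ∀ m → toℚᵘ (fromℕ m) ℚᵘ.≃ mkℚᵘ (ℤ.+ m) 0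
fromℕ-ᵘ m = ℚ.toℚᵘ-fromℚᵘ (mkℚᵘ (ℤ.+ m) 0)

fromℕ-* : ∀ m n → fromℕ (m ℕ.* n) ≡ fromℕ m ℚ.* fromℕ n
fromℕ-* m n = ℚ.toℚᵘ-injective (begin
  toℚᵘ (fromℕ (m ℕ.* n))                      ≈⟨ fromℕ-ᵘ (m ℕ.* n) ⟩
  mkℚᵘ (ℤ.+ (m ℕ.* n)) 0                      ≡⟨ cong (λ i → mkℚᵘ i 0) (ℤ.pos-* m n) ⟩
  mkℚᵘ (ℤ.+ m) 0 ℚᵘ.* mkℚᵘ (ℤ.+ n) 0          ≈⟨ ℚᵘ.*-cong (fromℕ-ᵘ m) (fromℕ-ᵘ n) ⟨
  toℚᵘ (fromℕ m) ℚᵘ.* toℚᵘ (fromℕ n)          ≈⟨ ℚ.toℚᵘ-homo-* (fromℕ m) (fromℕ n) ⟨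
  toℚᵘ (fromℕ m ℚ.* fromℕ n)                  ∎)
  where open ℚᵘ.≃-Reasoning

fromℕ-^ : ∀ m n → fromℕ (m ^ n) ≡ fromℕ m ^ℚ n
fromℕ-^ m zero    = refl
fromℕ-^ m (suc n) = trans (fromℕ-* m (m ^ n)) (cong (fromℕ m ℚ.*_) (fromℕ-^ m n))

fromℕ-≤⁺ : ∀ {c m n} (p : ℚᵘ.ℚᵘ) → toℚᵘ c ℚᵘ.≃ p → p ℚᵘ.* mkℚᵘ (ℤ.+ m) 0 ℚᵘ.≤ mkℚᵘ (ℤ.+ n) 0 → c ℚ.* fromℕ m ℚ.≤ fromℕ n
fromℕ-≤⁺ {c} {m} {n} p c≃p le = ℚ.toℚᵘ-cancel-≤ (begin
  toℚᵘ (c ℚ.* fromℕ m)         ≃⟨ ℚ.toℚᵘ-homo-* c (fromℕ m) ⟩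
  toℚᵘ c ℚᵘ.* toℚᵘ (fromℕ m)   ≃⟨ ℚᵘ.*-cong c≃p (fromℕ-ᵘ m) ⟩
  p ℚᵘ.* mkℚᵘ (ℤ.+ m) 0        ≤⟨ le ⟩
  mkℚᵘ (ℤ.+ n) 0               ≃⟨ fromℕ-ᵘ n ⟨
  toℚᵘ (fromℕ n)               ∎)
  where open ℚᵘ.≤-Reasoning

fromℕ-≤⁻ : ∀ {c m n} → c ℚ.* fromℕ m ℚ.≤ fromℕ n → toℚᵘ c ℚᵘ.* mkℚᵘ (ℤ.+ m) 0 ℚᵘ.≤ mkℚᵘ (ℤ.+ n) 0
fromℕ-≤⁻ {c} {m} {n} le = begin
  toℚᵘ c ℚᵘ.* mkℚᵘ (ℤ.+ m) 0   ≃⟨ ℚᵘ.*-cong (ℚᵘ.≃-refl {toℚᵘ c}) (fromℕ-ᵘ m) ⟨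
  toℚᵘ c ℚᵘ.* toℚᵘ (fromℕ m)   ≃⟨ ℚ.toℚᵘ-homo-* c (fromℕ m) ⟨
  toℚᵘ (c ℚ.* fromℕ m)         ≤⟨ ℚ.toℚᵘ-mono-≤ le ⟩
  toℚᵘ (fromℕ n)               ≃⟨ fromℕ-ᵘ n ⟩
  mkℚᵘ (ℤ.+ n) 0               ∎
  where open ℚᵘ.≤-Reasoning

-- For c = (p + 1) / (k + 1), clearing denominators gives (p + 1) m ≤ (k + 1) n. The numerator is at
-- least 1, so c may be weakened to 1 / (k + 1), with k taken from the denominator of c.
archimedean : ∀ c → 0ℚ ℚ.< c → ∃ λ k → ∀ {m n} → c ℚ.* fromℕ m ℚ.≤ fromℕ n → m ≤ suc k ℕ.* n
archimedean c@(mkℚ (ℤ.+ suc p) k _) 0<c = k , λ {m} {n} le → bound m n (fromℕ-≤⁻ {c} {m} {n} le)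
  where
  bound : ∀ m n → toℚᵘ c ℚᵘ.* mkℚᵘ (ℤ.+ m) 0 ℚᵘ.≤ mkℚᵘ (ℤ.+ n) 0 → m ≤ suc k ℕ.* n
  bound m n (*≤* le) = begin
    m                        ≤⟨ ℕ.m≤m+n m (p ℕ.* m) ⟩
    suc p ℕ.* m              ≤⟨ ℤ.drop‿+≤+ (subst₂ ℤ._≤_ lhs rhs le) ⟩
    suc k ℕ.* n              ∎
    where
    open ℕ.≤-Reasoning
    lhs : (ℤ.+ suc p ℤ.* ℤ.+ m) ℤ.* ℤ.+ 1 ≡ ℤ.+ (suc p ℕ.* m)
    lhs = trans (ℤ.*-identityʳ _) (sym (ℤ.pos-* (suc p) m))
    rhs : ℤ.+ n ℤ.* ℤ.+ (suc k ℕ.* 1) ≡ ℤ.+ (suc k ℕ.* n)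
    rhs = trans (sym (ℤ.pos-* n _)) (cong ℤ.+_ (trans (cong (n ℕ.*_) (ℕ.*-identityʳ (suc k))) (ℕ.*-comm n (suc k))))
archimedean (mkℚ (ℤ.+ zero) _ _) (ℚ.*<* (ℤ.+<+ ()))
archimedean (mkℚ ℤ.-[1+ _ ] _ _) (ℚ.*<* ())

unitFraction : ℕ → ℚ
unitFraction k = ℤ.+ 1 ℚ./ suc k

0<unitFraction : ∀ k → 0ℚ ℚ.< unitFraction k
0<unitFraction k = ℚ.positive⁻¹ (unitFraction k) {{ℚ.normalize-pos 1 (suc k)}}

-- Powers of a number in [0 , 1] do not exceed it. Taking C itself to be the reciprocal of the
-- integer constant therefore suffices, and no rational approximation to its (2n - 1)-th root has to
-- be found.
unitFraction-^ : ∀ k d → unitFraction k ^ℚ suc d ℚ.≤ unitFraction k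
unitFraction-^ k d = begin
  C ℚ.* C ^ℚ d     ≤⟨ ℚ.*-monoˡ-≤-nonNeg C (≤1 d) ⟩
  C ℚ.* 1ℚ         ≡⟨ ℚ.*-identityʳ C ⟩
  C                ∎
  where
  open ℚ.≤-Reasoning
  C = unitFraction k
  instance
    C≥0 : ℚ.NonNegative C
    C≥0 = ℚ.normalize-nonNeg 1 (suc k)
  C≤1 : C ℚ.≤ 1ℚ
  C≤1 = ℚ.toℚᵘ-cancel-≤ (ℚᵘ.≤-respˡ-≃ (ℚᵘ.≃-sym (ℚ.toℚᵘ-fromℚᵘ (mkℚᵘ (ℤ.+ 1) k))) (*≤* (ℤ.+≤+ (s≤s z≤n))))
  ≤1 : ∀ d → C ^ℚ d ℚ.≤ 1ℚ
  ≤1 zero    = ℚ.≤-refl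
  ≤1 (suc d) = begin
    C ℚ.* C ^ℚ d   ≤⟨ ℚ.*-monoˡ-≤-nonNeg C (≤1 d) ⟩
    C ℚ.* 1ℚ       ≡⟨ ℚ.*-identityʳ C ⟩
    C              ≤⟨ C≤1 ⟩
    1ℚ             ∎

unitFraction-root : ∀ k {x y} d → x ≤ suc k ℕ.* y ^ suc d → unitFraction k · x ^1/ suc d ≤ y
unitFraction-root k {x} {y} d le = begin
  C ^ℚ suc d ℚ.* fromℕ x      ≤⟨ ℚ.*-monoʳ-≤-nonNeg (fromℕ x) {{ℚ.normalize-nonNeg x 1}} (unitFraction-^ k d) ⟩
  C ℚ.* fromℕ x               ≤⟨ fromℕ-≤⁺ {C} {x} {y ^ suc d} (mkℚᵘ (ℤ.+ 1) k) (ℚ.toℚᵘ-fromℚᵘ _) (*≤* (subst₂ ℤ._≤_ (sym lhs) (sym rhs) (ℤ.+≤+ le))) ⟩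
  fromℕ (y ^ suc d)           ≡⟨ fromℕ-^ y (suc d) ⟩
  fromℕ y ^ℚ suc d            ∎
  where
  open ℚ.≤-Reasoning
  C = unitFraction k
  lhs : (ℤ.+ 1 ℤ.* ℤ.+ x) ℤ.* ℤ.+ 1 ≡ ℤ.+ x
  lhs = trans (ℤ.*-identityʳ _) (ℤ.*-identityˡ _)
  rhs : ℤ.+ (y ^ suc d) ℤ.* ℤ.+ (suc k ℕ.* 1) ≡ ℤ.+ (suc k ℕ.* y ^ suc d)
  rhs = trans (sym (ℤ.pos-* (y ^ suc d) _)) (cong ℤ.+_ (trans (cong (y ^ suc d ℕ.*_) (ℕ.*-identityʳ (suc k))) (ℕ.*-comm (y ^ suc d) (suc k))))

-- Cardinalities as sums, parity, and closure properties of the sum sets.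

∑-lookup : ∀ {n} (A : Subset n) → ∑[ i ∈ allFin n ] ⟦ lookup A i ⟧ ≡ ∣ A ∣
∑-lookup []          = refl
∑-lookup (true  ∷ A) = trans (∑-allFin-suc (λ i → ⟦ lookup (true ∷ A) i ⟧)) (cong suc (∑-lookup A))
∑-lookup (false ∷ A) = trans (∑-allFin-suc (λ i → ⟦ lookup (false ∷ A) i ⟧)) (∑-lookup A)

parity : ∀ n → 2 ∣ℕ n ⊎ ∃ λ h → n ≡ suc (h + h)
parity zero    = inj₁ (divides 0 refl)
parity (suc n) with parity n
... | inj₁ (divides h refl) = inj₂ (h , cong suc (solve 1 (λ h → h :* con 2 := h :+ h) refl h))
  where open +-*-Solver
... | inj₂ (h , refl)       = inj₁ (divides (suc h) (cong (2 +_) (solve 1 (λ h → h :+ h := h :* con 2) refl h)))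
  where open +-*-Solver

2∤^ : ∀ {m} → ¬ (2 ∣ℕ m) → ∀ n → ¬ (2 ∣ℕ m ^ n)
2∤^ 2∤m zero    2∣ = contradiction (∣1⇒≡1 2∣) λ ()
2∤^ {m} 2∤m (suc n) 2∣ with euclidsLemma m (m ^ n) prime[2] 2∣
... | inj₁ 2∣m  = 2∤m 2∣m
... | inj₂ 2∣mⁿ = 2∤^ 2∤m n 2∣mⁿ

oddPrimePower-nonZero : ∀ {q} → IsOddPrimePower q → NonZero q
oddPrimePower-nonZero (p , k , p-prime , _ , _ , refl) = ℕ.m^n≢0 p k {{prime⇒nonZero p-prime}}

oddPrimePower-odd : ∀ {q} → IsOddPrimePower q → ¬ (2 ∣ℕ q)
oddPrimePower-odd (p , k , _ , 2∤p , _ , refl) = 2∤^ 2∤p k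

module _ {a ℓ} (R : FiniteCommutativeRing a ℓ) where
  open FiniteCommutativeRing R using (order; element; index; enumeration; SubsetR; _∈_; _⊕_; squares; _-foldSum_; 0#)
  private module R = FiniteCommutativeRing R
  open FiniteRing R
  open Core isIndexRing using (normSq)

  ⊕-lookup : ∀ {A B i j} → lookup A i ≡ true → lookup B j ≡ true → lookup (A ⊕ B) (index (element i R.+ element j)) ≡ true
  ⊕-lookup {A} {B} {i} {j} Ai Bj = []=⇒lookup (⊕-∈ {A} {B} (member A Ai) (member B Bj))
    where
    member : ∀ C {k} → lookup C k ≡ true → element k ∈ C
    member C {k} Ck = subst (Sub._∈ C) (sym (index-element k)) (lookup⇒[]= k C Ck)

  normSq-foldSum : ∀ (A : SubsetR) {m} (v : Vec (Fin order) m) → allᵇ (lookup A) v ≡ true →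
                   lookup (m -foldSum squares A) (normSq v) ≡ true
  normSq-foldSum A []      _  = []=⇒lookup (x∈⁅x⁆ (index 0#))
  normSq-foldSum A (x ∷ v) ev with lookup A x in ex
  ... | true = ⊕-lookup {squares A} square (normSq-foldSum A v ev)
    where
    square : lookup (squares A) (index (element x R.* element x)) ≡ true
    square = []=⇒lookup (squares-∈ {A} (subst (Sub._∈ A) (sym (index-element x)) (lookup⇒[]= x A ex)))

  -- Translation by any fixed element of A embeds A into A ⊕ A.
  ∣A∣≤∣A⊕A∣ : ∀ (A : SubsetR) → .{{NonZero ∣ A ∣}} → ∣ A ∣ ≤ ∣ A ⊕ A ∣
  ∣A∣≤∣A⊕A∣ A with any? (λ i → lookup A i Bool.≟ true)
  ... | yes (i , Ai) = begin
    ∣ A ∣                                                                ≡⟨ ∑-lookup A ⟨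
    ∑[ j ∈ allFin order ] ⟦ lookup A j ⟧                                 ≤⟨ ∑-mono (allFin order) translate ⟩
    ∑[ j ∈ allFin order ] ⟦ lookup (A ⊕ A) (index (element i R.+ element j)) ⟧
      ≤⟨ ∑-injective (λ j → index (element i R.+ element j))
           (λ e → element-injective (+-cancelˡ (element i) _ _ (index-injective e))) (λ k → ⟦ lookup (A ⊕ A) k ⟧) ⟩
    ∑[ k ∈ allFin order ] ⟦ lookup (A ⊕ A) k ⟧                           ≡⟨ ∑-lookup (A ⊕ A) ⟩
    ∣ A ⊕ A ∣                                                            ∎
    where
    open ℕ.≤-Reasoning
    open import Algebra.Properties.Ring R.ring using (+-cancelˡ)
    translate : ∀ j → ⟦ lookup A j ⟧ ≤ ⟦ lookup (A ⊕ A) (index (element i R.+ element j)) ⟧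
    translate j with lookup A j in Aj
    ... | false = z≤n
    ... | true  = ℕ.≤-reflexive (sym (cong ⟦_⟧ (⊕-lookup {A} {A} Ai Aj)))
  ... | no ∄i = ℕ.≤-trans (ℕ.≤-reflexive (sym (∑-lookup A))) (ℕ.≤-trans (∑-mono (allFin order) {g = λ _ → 0} none)
                 (ℕ.≤-trans (ℕ.≤-reflexive (trans (∑-const (allFin order) 0) (ℕ.*-zeroʳ (length (allFin order))))) z≤n))
    where
    none : ∀ i → ⟦ lookup A i ⟧ ≤ 0
    none i with lookup A i in Ai
    ... | false = z≤n
    ... | true  = contradiction (i , Ai) ∄i

-- The estimate for a subset of a finite valuation ring.

module _ {a ℓ} (R : FiniteValuationRing a ℓ)
         (z : FiniteValuationRing.Carrier R) (uniformizer : FiniteValuationRing.IsUniformizer R z)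
         (q : ℕ) (quotient-order : FiniteValuationRing.QuotientHasOrder R z q) (q-odd : IsOddPrimePower q)
         (r : ℕ) (nilpotency : FiniteValuationRing.IsNilpotencyIndex R z r)
         (A : FiniteValuationRing.SubsetR R) (A-large : 2 * q ^ (r ∸ 1) ≤ ∣ A ∣) where

  private
    module R = FiniteValuationRing R
    open R using (order; index; element; _⊕_; squares; _-foldSum_)
    open FiniteRing R.finiteCommutativeRing
    open Valuation R.finiteCommutativeRing z uniformizer r nilpotency
    open Digits q quotient-order
    open Core isIndexRing using (Unit; module Local)

    toUnit : ∀ {i} → (∃ λ y → element i R.* y R.≈ R.1#) → Unit i
    toUnit (y , e) = index y , index-cong (R.trans (R.*-congˡ (element-index y)) e)

    fromUnit : ∀ {i} → Unit i → ∃ λ y → element i R.* y R.≈ R.1#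
    fromUnit (j , e) = element j , index-injective e

    abstract
      unit? : ∀ i → Unit i ⊎ ∃ λ j → index (nonunit j) ≡ i
      unit? i = Sum.map toUnit
        (λ z∣ → let j , e = nonunit-surjective z∣ in j , trans (index-cong e) (index-element i))
        (unit⊎z∣ (element i))

      unit-+ : ∀ {i j} → Unit (index (element i R.+ element j)) → Unit i ⊎ Unit j
      unit-+ u = let y , e = fromUnit u in
        Sum.map toUnit toUnit (unit-+⇒unit (y , R.trans (R.*-congʳ (R.sym (element-index _))) e))

      unit-2 : Unit (index (element (index R.1#) R.+ element (index R.1#)))
      unit-2 with parity order
      ... | inj₁ even      = contradiction (subst (2 ∣ℕ_) order≡q^r even) (2∤^ (oddPrimePower-odd q-odd) r)
      ... | inj₂ (h , odd) with y , e ← odd⇒unit-2 {h} odd = toUnit (y , R.trans (R.*-congʳ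
              (R.trans (element-index _) (R.+-cong (element-index R.1#) (element-index R.1#)))) e)

    instance
      q≢0 : NonZero q
      q≢0 = oddPrimePower-nonZero q-odd
      w≢0 : NonZero (q ^ (r ∸ 1))
      w≢0 = ℕ.m^n≢0 q (r ∸ 1)
      q^r≢0 : NonZero (q ^ r)
      q^r≢0 = ℕ.m^n≢0 q r
      A≢∅ : NonZero ∣ A ∣
      A≢∅ = ℕ.>-nonZero (ℕ.<-≤-trans (ℕ.>-nonZero⁻¹ (2 * q ^ (r ∸ 1)) {{ℕ.m*n≢0 2 (q ^ (r ∸ 1))}}) A-large)

  sumset-or-squares : ∀ m k →
    q ^ r * ((q ^ (r ∸ 1)) ^ m * (q ^ r) ^ m) ≤ suc k * (∣ A ⊕ A ∣ ^ m * (∣ A ∣ * ∣ A ∣ ^ m)) →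
    let M = ∣ A ⊕ A ∣ ⊔ ∣ suc m -foldSum squares A ∣ in
    q ^ r * (∣ A ∣ ^ m * ∣ A ∣ ^ m) ≤ 16 * suc k * (M * (M ^ m * M ^ m))
  sumset-or-squares m k = max-bound (q ^ r) (q ^ (r ∸ 1)) m (∣ A ∣) (∣ A ⊕ A ∣) (∣ suc m -foldSum squares A ∣) k
    (∣A∣≤∣A⊕A∣ R.finiteCommutativeRing A) dichotomy
    where
    open Local (q ^ (r ∸ 1)) (index ∘ nonunit) unit? unit-+ unit-2
    dichotomy : q ^ r * ∣ A ∣ ^ m ≤ 2 * (∣ A ⊕ A ∣ ^ m * ∣ suc m -foldSum squares A ∣) ⊎
      ∣ A ∣ ^ m * ∣ A ∣ ^ m * ∣ A ∣ ^ m * ∣ A ∣ ≤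
        16 * (∣ A ⊕ A ∣ ^ m * ∣ suc m -foldSum squares A ∣ * ((q ^ (r ∸ 1)) ^ m * (q ^ r) ^ m))
    dichotomy = conclude (∑-lookup A) (∑-lookup (A ⊕ A)) (∑-lookup (suc m -foldSum squares A)) order≡q^r A-large
      (sumsOfSquares-incidences (lookup A) (lookup (A ⊕ A)) (lookup (suc m -foldSum squares A)) m closed foldSum)
      (units-majority (lookup A) (lookup (A ⊕ A)) (lookup (suc m -foldSum squares A)) m closed foldSum)
      where
      w = q ^ (r ∸ 1)
      closed = ⊕-lookup R.finiteCommutativeRing {A} {A}
      foldSum = normSq-foldSum R.finiteCommutativeRing A
      -- Stated for variables so that matching on `refl` turns the sums into cardinalities and the
      -- order into q^r all at once.
      conclude : ∀ {α a β b τ t N Q υ} → α ≡ a → β ≡ b → τ ≡ t → N ≡ Q → .{{_ : NonZero a}} → .{{_ : NonZero Q}} → 2 * w ≤ a →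
        (∃ λ S → N * (α ^ m * υ * α ^ m) ≤ S + β ^ m * τ * (α ^ m * υ) ×
                 S * S ≤ β ^ m * τ * (N * (α ^ m * υ * (w ^ m * (N * (N ^ m * 2)))))) →
        α ≤ υ + w →
        Q * a ^ m ≤ 2 * (b ^ m * t) ⊎ a ^ m * a ^ m * a ^ m * a ≤ 16 * (b ^ m * t * (w ^ m * Q ^ m))
      conclude {a = a} {b = b} {t = t} {Q = Q} {υ} refl refl refl refl 2w≤a (S , incidences , squared) majority =
        main-or-error Q w m a υ (b ^ m * t) S 2w≤a majority incidences squared

-- Matching exponents and constants with the stated form.

-- Splitting 2r - 1 as (r - 1) + r turns the power of q in the hypothesis into N wᵐ Nᵐ, whose factor
-- wᵐ Nᵐ cancels in `max-bound`.
exponent : ∀ q m r → 0 < r → q ^ (r + m * (2 * r ∸ 1)) ≡ q ^ r * ((q ^ (r ∸ 1)) ^ m * (q ^ r) ^ m)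
exponent q m r@(suc r′) _ = begin
  q ^ (r + m * (2 * r ∸ 1))                ≡⟨ ℕ.^-distribˡ-+-* q r _ ⟩
  q ^ r * q ^ (m * (2 * r ∸ 1))            ≡⟨ cong (λ e → q ^ r * q ^ e) (trans (ℕ.*-comm m (2 * r ∸ 1)) (cong (λ e → (r′ + e) * m) (ℕ.+-identityʳ r))) ⟩
  q ^ r * q ^ ((r′ + r) * m)               ≡⟨ cong (λ e → q ^ r * q ^ e) (ℕ.*-distribʳ-+ m r′ r) ⟩
  q ^ r * q ^ (r′ * m + r * m)             ≡⟨ cong (q ^ r *_) (ℕ.^-distribˡ-+-* q (r′ * m) (r * m)) ⟩
  q ^ r * (q ^ (r′ * m) * q ^ (r * m))     ≡⟨ cong₂ (λ u v → q ^ r * (u * v)) (sym (ℕ.^-*-assoc q r′ m)) (sym (ℕ.^-*-assoc q r m)) ⟩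
  q ^ r * ((q ^ r′) ^ m * (q ^ r) ^ m)     ∎
  where open ≡-Reasoning

-- As `unitFraction j` is 1 / (j + 1), the index 15 + 16 k encodes the constant 1 / (16 (k + 1)).
rootForm : ∀ q r m k a M → q ^ r * (a ^ m * a ^ m) ≤ 16 * suc k * (M * (M ^ m * M ^ m)) →
           unitFraction (15 + 16 * k) · (q ^ r * a ^ (2 * suc m ∸ 2)) ^1/ (2 * suc m ∸ 1) ≤ M
-- The exponent 2n - 2 is read as d - 1 with d = 2n - 1, so the single equation `2n-1` rewrites both
-- the exponent and the root.
rootForm q r m k a M le = subst (λ d → unitFraction (15 + 16 * k) · (q ^ r * a ^ (d ∸ 1)) ^1/ d ≤ M) (sym 2n-1)
  (unitFraction-root (15 + 16 * k) {q ^ r * a ^ (m + m)} {M} (m + m) (begin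
    q ^ r * a ^ (m + m)                        ≡⟨ cong (q ^ r *_) (ℕ.^-distribˡ-+-* a m m) ⟩
    q ^ r * (a ^ m * a ^ m)                    ≤⟨ le ⟩
    16 * suc k * (M * (M ^ m * M ^ m))         ≡⟨ cong₂ (λ u v → u * (M * v)) (ℕ.*-suc 16 k) (sym (ℕ.^-distribˡ-+-* M m m)) ⟩
    suc (15 + 16 * k) * M ^ suc (m + m)        ∎))
  where
  open ℕ.≤-Reasoning
  2n-1 : 2 * suc m ∸ 1 ≡ suc (m + m)
  2n-1 = trans (cong (λ t → m + suc t) (ℕ.+-identityʳ m)) (ℕ.+-suc m m)

theorem1p8 : ∀ {a ℓ : Level} (n : ℕ) → 1 < n →
    ∀ (c : ℚ) → 0ℚ <ℚ c →
    ∃ λ (C : ℚ) → 0ℚ <ℚ C ×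
    (∀ (R : FiniteValuationRing a ℓ) → let module R = FiniteValuationRing R in
    ∀ (z : R.Carrier) → R.IsUniformizer z →
    ∀ (q : ℕ) → R.QuotientHasOrder z q → IsOddPrimePower q →
    ∀ (r : ℕ) → R.IsNilpotencyIndex z r →
    ∀ (A : R.SubsetR) →
    2 * q ^ (r ∸ 1) ≤ ∣ A ∣ →
    c *ℚ fromℕ (q ^ (r + (n ∸ 1) * (2 * r ∸ 1)))
    ≤ℚ fromℕ (∣ A R.⊕ A ∣ ^ (n ∸ 1) * ∣ A ∣ ^ n) →
    C · (q ^ r * ∣ A ∣ ^ (2 * n ∸ 2)) ^1/ (2 * n ∸ 1)
    ≤ (∣ A R.⊕ A ∣ ⊔ ∣ n R.-foldSum (R.squares A) ∣))
theorem1p8 (suc m) _ c 0<c =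
  let k , c-bound = archimedean c 0<c in
  unitFraction (15 + 16 * k) , 0<unitFraction (15 + 16 * k) ,
  λ R z uniformizer q quotient-order q-odd r nilpotency A A-large hyp →
    let module R = FiniteValuationRing R
        M = ∣ A R.⊕ A ∣ ⊔ ∣ suc m R.-foldSum (R.squares A) ∣
    in rootForm q r m k (∣ A ∣) M (sumset-or-squares R z uniformizer q quotient-order q-odd r nilpotency A A-large m k
         (subst (_≤ suc k * (∣ A R.⊕ A ∣ ^ m * (∣ A ∣ * ∣ A ∣ ^ m)))
           (exponent q m r (R.IsNilpotencyIndex.positive nilpotency)) (c-bound hyp)))
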